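{- There is a polynomial $F(y,n,s,x,w,k,l,m,i,j,v_1,v_2,v_3)$ with integer coefficients such that for all natural numbers $y,n,s$ with $n\ge s>0$: $y=\binom{n}{s}$ holds if and only if there exist natural numbers $x,w,k,l,m,i,j,v_1,v_2,v_3$ with $F(y,n,s,x,w,k,l,m,i,j,v_1,v_2,v_3)=0$.
   Context: All variables range over the natural numbers $\{0,1,2,\ldots\}$; $\binom{n}{s}$ denotes the binomial coefficient. -}

module Defs where

open import Data.Nat using (ℕ)
open import Data.Fin using (Fin)
open import Data.Integer using (ℤ; +_) renaming (_+_ to _+ℤ_; _*_ to _*ℤ_)

-- Multivariate polynomials with integer coefficients in n variables,
-- given syntactically (constants, variables, sums, products).
-- Subtraction is expressible as p + (const -1) * q.
data Poly (n : ℕ) : Set where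
  const : ℤ → Poly n
  var   : Fin n → Poly n
  _⊕_   : Poly n → Poly n → Poly n
  _⊗_   : Poly n → Poly n → Poly n

eval : ∀ {n} → Poly n → (Fin n → ℤ) → ℤ
eval (const c) ρ = c
eval (var i)   ρ = ρ i
eval (p ⊕ q)   ρ = eval p ρ +ℤ eval q ρ
eval (p ⊗ q)   ρ = eval p ρ *ℤ eval q ρ

evalℕ : ∀ {n} → Poly n → (Fin n → ℕ) → ℤ
evalℕ p ρ = eval p (λ i → + (ρ i))

{-# OPTIONS --safe #-}

-- The binomial coefficient is the digit of weight uˢ of (1 + u)ⁿ in a base u > 2ⁿ, hence the last
-- base-u digit of the integer part of (1 + u)ⁿ / uˢ.  Writing Y d n for the n-th solution of the Pell
-- equation x² = d (d + 2) y² + 1, the estimate (2d + 1)ⁿ ≤ Y d (n + 1) ≤ (2d + 2)ⁿ shows that for R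
-- much larger than (1 + u)ⁿ this integer part is that of
--   Y (R (1 + u)) (n + 1) / (Y R (n - s + 1) · Y (R u) (s + 1)).
-- The numerator K is singled out by Matiyasevich's criterion.  The congruence Y d n ≡ n (mod d)
-- identifies the two smaller Pell numbers, Y d n ≡ Y 2 n (mod d - 2) makes u = Y 2 (n + 1), and a Pell
-- solution whose second coordinate is divisible by its parameter is exponentially large, which
-- makes R large.
-- All Pell equations say that some number is a square.  Those of the criterion and of the growth
-- condition concern pairwise coprime numbers, so they merge into the squareness of one product Z.
-- That Z is a square and that K / (L P) has the right integer part is expressed by one unknown, and so
-- are the two remaining square conditions; this leaves ten unknowns.
module Submission where

open import Defs
open import Data.Fin using (Fin; #_; toℕ; fromℕ<; combine)
open import Data.Fin.Properties using (pigeonhole; combine-injective; fromℕ<-injective)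
open import Data.Integer as ℤ using (ℤ; +_; -[1+_]; ∣_∣)
import Data.Integer.Properties as ℤ
import Data.Integer.Tactic.RingSolver as ℤ-Solver
open import Data.Nat
open import Data.Nat.Combinatorics using (_C_; nCk+nC[k+1]≡[n+1]C[k+1])
open import Data.Nat.Coprimality using (Coprime; coprime-divisor; coprime⇒gcd≡1; coprime-/gcd)
open import Data.Nat.Divisibility
open import Data.Nat.DivMod
open import Data.Nat.GCD using (gcd; gcd[m,n]∣m; gcd[m,n]∣n; c*gcd[m,n]≡gcd[cm,cn])
open import Data.Nat.Induction using (<-rec)
open import Data.Nat.Properties
open import Data.Nat.Tactic.RingSolver using (solve-∀)
open import Data.Product hiding (swap)
open import Data.Sum using (inj₁; inj₂)
open import Data.Vec using (lookup; _∷_; [])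
open import Function.Bundles using (_⇔_; mk⇔)
open import Relation.Binary.Definitions using (tri<; tri≈; tri>)
open import Relation.Binary.PropositionalEquality
open import Relation.Nullary using (contradiction; yes; no)

-- The soundness direction has to avoid a circle. Identifying `u`, `L`, `P` and the quotient needs
-- `R` to be large, but largeness rests on `S` being a square, which is known only through the
-- product `Z`. So `Z` is split by coprimality alone, without any size estimate on `R`: `S` divides
-- `R` and hence `d = R (1 + u)` by the way `R` is written, and the remaining factors are coprime by
-- the shape of `B` and `b`. The criterion for `K` needs only `n < K`, which the form `K = u + e k`
-- with `n < u` provides. Only then does the squareness of `S` yield the growth of `R`. The
-- inequalities `q L P < K < (q + 1) L P` and `0 < y` form a single sign condition, which can be
-- absorbed by the form that tests whether `Z` is a square. Positivity of `y` has work to do: it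
-- gives `L P ≤ K`, and thereby a bound on the indices of `L` and `P`, whose congruences determine
-- those indices only modulo `R` and `R u`.

-- Congruences of natural numbers, also up to sign

infix 4 _≈_[mod_] _≈±_[mod_]

record _≈_[mod_] (a b m : ℕ) : Set where
  constructor witness
  field
    {left right} : ℕ
    balance      : a + m * left ≡ b + m * right

-- The sign is needed because modulo `X d m` the sequence `Y d` repeats only up to sign. `opposite`
-- is `a ≡ -b` without subtraction.
data _≈±_[mod_] (a b m : ℕ) : Set where
  same     : a ≈ b [mod m ] → a ≈± b [mod m ]
  opposite : m ∣ a + b → a ≈± b [mod m ]

≈-refl : ∀ {m a} → a ≈ a [mod m ]
≈-refl = witness {left = 0} {0} refl

≈-sym : ∀ {m a b} → a ≈ b [mod m ] → b ≈ a [mod m ]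
≈-sym (witness {k} {l} e) = witness (sym e)

≈-trans : ∀ {m a b c} → a ≈ b [mod m ] → b ≈ c [mod m ] → a ≈ c [mod m ]
≈-trans {m} {a} {b} {c} (witness {k} {l} e) (witness {k′} {l′} e′) = witness {left = k + k′} {l + l′} (begin
  a + m * (k + k′)      ≡⟨ split m a k k′ ⟩
  (a + m * k) + m * k′  ≡⟨ cong (_+ m * k′) e ⟩
  (b + m * l) + m * k′  ≡⟨ swap m b l k′ ⟩
  (b + m * k′) + m * l  ≡⟨ cong (_+ m * l) e′ ⟩
  (c + m * l′) + m * l  ≡⟨ swap m c l′ l ⟩
  (c + m * l) + m * l′  ≡⟨ split m c l l′ ⟨
  c + m * (l + l′)      ∎)
  where
  open ≡-Reasoning
  split : ∀ m a k k′ → a + m * (k + k′) ≡ (a + m * k) + m * k′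
  split = solve-∀
  swap : ∀ m a k k′ → (a + m * k) + m * k′ ≡ (a + m * k′) + m * k
  swap = solve-∀

≈-∣ : ∀ {m n a b} → n ∣ m → a ≈ b [mod m ] → a ≈ b [mod n ]
≈-∣ {m} {n} {a} {b} (divides q m≡qn) (witness {k} {l} e) = witness {left = q * k} {q * l}
  (trans (cong (λ z → a + z) (move k)) (trans e (cong (λ z → b + z) (sym (move l)))))
  where
  assoc : ∀ n q k → n * (q * k) ≡ q * n * k
  assoc = solve-∀
  move : ∀ k → n * (q * k) ≡ m * k
  move k = trans (assoc n q k) (cong (_* k) (sym m≡qn))

≈-∣-+ : ∀ {m a b c} → a ≈ b [mod m ] → m ∣ b + c → m ∣ a + c
≈-∣-+ {m} {a} {b} {c} (witness {k} {l} e) m∣b+c = ∣m+n∣m⇒∣n {m} {m * k} {a + c} m∣s (m∣m*n k)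
  where
  rearrange : ∀ a b c → a + (b + c) ≡ b + a + c
  rearrange = solve-∀
  rearrange′ : ∀ b c d → (b + d) + c ≡ d + (b + c)
  rearrange′ = solve-∀
  m∣s : m ∣ m * k + (a + c)
  m∣s = subst (m ∣_) (sym (trans (rearrange (m * k) a c) (trans (cong (_+ c) e) (rearrange′ b c (m * l)))))
          (∣m∣n⇒∣m+n (m∣m*n l) m∣b+c)

∣-+-≈ : ∀ {m a b c} → m ∣ a + b → m ∣ b + c → a ≈ c [mod m ]
∣-+-≈ {m} {a} {b} {c} (divides q e) (divides q′ e′) = witness {left = q′} {q} (begin
  a + m * q′    ≡⟨ cong (λ z → a + z) (trans (*-comm m q′) (sym e′)) ⟩
  a + (b + c)   ≡⟨ rearrange a b c ⟩
  c + (a + b)   ≡⟨ cong (λ z → c + z) (trans e (*-comm q m)) ⟩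
  c + m * q     ∎)
  where
  open ≡-Reasoning
  rearrange : ∀ a b c → a + (b + c) ≡ c + (a + b)
  rearrange = solve-∀

≈±-sym : ∀ {m a b} → a ≈± b [mod m ] → b ≈± a [mod m ]
≈±-sym (same p) = same (≈-sym p)
≈±-sym {m} {a} {b} (opposite p) = opposite (subst (m ∣_) (+-comm a b) p)

≈±-trans : ∀ {m a b c} → a ≈± b [mod m ] → b ≈± c [mod m ] → a ≈± c [mod m ]
≈±-trans (same p) (same q) = same (≈-trans p q)
≈±-trans (same p) (opposite q) = opposite (≈-∣-+ p q)
≈±-trans {m} {a} {b} {c} (opposite p) (same q) =
  opposite (subst (m ∣_) (+-comm c a) (≈-∣-+ (≈-sym q) (subst (m ∣_) (+-comm a b) p)))
≈±-trans (opposite p) (opposite q) = same (∣-+-≈ p q)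

≈±-∣ : ∀ {m n a b} → n ∣ m → a ≈± b [mod m ] → a ≈± b [mod n ]
≈±-∣ n∣m (same p) = same (≈-∣ n∣m p)
≈±-∣ n∣m (opposite p) = opposite (∣-trans n∣m p)

≈-<-≡ : ∀ {m a b} → a ≈ b [mod m ] → a < m → b < m → a ≡ b
≈-<-≡ {m@(suc _)} {a} {b} (witness {k} {l} e) a<m b<m = begin
  a                ≡⟨ m<n⇒m%n≡m a<m ⟨
  a % m            ≡⟨ [m+kn]%n≡m%n a k m ⟨
  (a + k * m) % m  ≡⟨ cong (λ z → (a + z) % m) (*-comm k m) ⟩
  (a + m * k) % m  ≡⟨ cong (_% m) e ⟩
  (b + m * l) % m  ≡⟨ cong (λ z → (b + z) % m) (*-comm m l) ⟩
  (b + l * m) % m  ≡⟨ [m+kn]%n≡m%n b l m ⟩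
  b % m            ≡⟨ m<n⇒m%n≡m b<m ⟩
  b                ∎
  where open ≡-Reasoning

-- Pell sequences: identities, growth, congruences

Δ : ℕ → ℕ
Δ d = d * (2 + d)

-- `X d n + Y d n √Δ` is the `n`-th power of the fundamental unit `1 + d + √Δ`. With `a = 1 + d`,
-- `Δ d` is `a² - 1` and `Y d (suc n)` is the Chebyshev value `U_n(a)`.
X Y : ℕ → ℕ → ℕ
X d zero    = 1
X d (suc n) = (1 + d) * X d n + Δ d * Y d n
Y d zero    = 0
Y d (suc n) = X d n + (1 + d) * Y d n

Square : ℕ → Set
Square n = ∃ λ r → r * r ≡ n

pell : ∀ d n → X d n * X d n ≡ Δ d * (Y d n * Y d n) + 1
pell d zero    = cong (_+ 1) (sym (*-zeroʳ (Δ d)))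
pell d (suc n) = +-cancelʳ-≡ (Δ d * (y * y)) _ _ (begin
  x′ * x′ + Δ d * (y * y)              ≡⟨ expand d x y ⟩
  Δ d * (y′ * y′) + x * x              ≡⟨ cong (λ z → Δ d * (y′ * y′) + z) (pell d n) ⟩
  Δ d * (y′ * y′) + (Δ d * (y * y) + 1) ≡⟨ move (Δ d * (y′ * y′)) (Δ d * (y * y)) ⟩
  Δ d * (y′ * y′) + 1 + Δ d * (y * y)  ∎)
  where
  open ≡-Reasoning
  x = X d n
  y = Y d n
  x′ = X d (suc n)
  y′ = Y d (suc n)
  expand : ∀ d x y → ((1 + d) * x + d * (2 + d) * y) * ((1 + d) * x + d * (2 + d) * y) + d * (2 + d) * (y * y)
                   ≡ d * (2 + d) * ((x + (1 + d) * y) * (x + (1 + d) * y)) + x * x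
  expand = solve-∀
  move : ∀ a b → a + (b + 1) ≡ a + 1 + b
  move = solve-∀

XY-+ : ∀ d m n → X d (m + n) ≡ X d m * X d n + Δ d * (Y d m * Y d n)
               × Y d (m + n) ≡ X d m * Y d n + Y d m * X d n
XY-+ d zero n = base₁ (X d n) (Δ d) , base₂ (Y d n)
  where
  base₁ : ∀ x e → x ≡ 1 * x + e * 0
  base₁ = solve-∀
  base₂ : ∀ y → y ≡ 1 * y + 0
  base₂ = solve-∀
XY-+ d (suc m) n with XY-+ d m n
... | eˣ , eʸ =
  trans (cong₂ (λ u v → (1 + d) * u + Δ d * v) eˣ eʸ) (step₁ d (Δ d) (X d m) (Y d m) (X d n) (Y d n)) ,
  trans (cong₂ (λ u v → u + (1 + d) * v) eˣ eʸ) (step₂ d (Δ d) (X d m) (Y d m) (X d n) (Y d n))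
  where
  step₁ : ∀ d e x y u v → (1 + d) * (x * u + e * (y * v)) + e * (x * v + y * u)
                       ≡ ((1 + d) * x + e * y) * u + e * ((x + (1 + d) * y) * v)
  step₁ = solve-∀
  step₂ : ∀ d e x y u v → (x * u + e * (y * v)) + (1 + d) * (x * v + y * u)
                       ≡ ((1 + d) * x + e * y) * v + (x + (1 + d) * y) * u
  step₂ = solve-∀

X-+ : ∀ d m n → X d (m + n) ≡ X d m * X d n + Δ d * (Y d m * Y d n)
X-+ d m n = proj₁ (XY-+ d m n)

Y-+ : ∀ d m n → Y d (m + n) ≡ X d m * Y d n + Y d m * X d n
Y-+ d m n = proj₂ (XY-+ d m n)

-- Multiplying by the conjugate of the `m`-th power of the unit undoes the shift by `m`; this is the
-- subtraction formula for `Y`.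
Y-∸ : ∀ d m n → Y d (m + n) * X d m ≡ Y d n + X d (m + n) * Y d m
Y-∸ d m n = +-cancelʳ-≡ (Δ d * (y * y) * Y d n) _ _ (begin
  Y d (m + n) * x + Δ d * (y * y) * v        ≡⟨ cong (λ z → z * x + Δ d * (y * y) * v) (Y-+ d m n) ⟩
  (x * v + y * u) * x + Δ d * (y * y) * v    ≡⟨ expand (Δ d) x y u v ⟩
  (x * u + Δ d * (y * v)) * y + (x * x) * v  ≡⟨ cong₂ (λ z w → z * y + w * v) (sym (X-+ d m n)) (pell d m) ⟩
  X d (m + n) * y + (Δ d * (y * y) + 1) * v  ≡⟨ move (X d (m + n) * y) (Δ d * (y * y)) v ⟩
  v + X d (m + n) * y + Δ d * (y * y) * v    ∎)
  where
  open ≡-Reasoning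
  x = X d m
  y = Y d m
  u = X d n
  v = Y d n
  expand : ∀ e x y u v → (x * v + y * u) * x + e * (y * y) * v ≡ (x * u + e * (y * v)) * y + (x * x) * v
  expand = solve-∀
  move : ∀ a b v → a + (b + 1) * v ≡ v + a + b * v
  move = solve-∀

1≤X : ∀ d n → 1 ≤ X d n
1≤X d zero    = ≤-refl
1≤X d (suc n) = ≤-trans (1≤X d n) (≤-trans (m≤m+n (X d n) (d * X d n)) (m≤m+n _ _))

dY<X : ∀ d n → d * Y d n < X d n
dY<X d zero    = s≤s (≤-reflexive (*-zeroʳ d))
dY<X d (suc n) = begin-strict
  d * (x + (1 + d) * y)       <⟨ m<n+m _ (1≤X d n) ⟩
  x + d * (x + (1 + d) * y)   ≤⟨ m≤m+n _ (d * y) ⟩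
  x + d * (x + (1 + d) * y) + d * y ≡⟨ expand d x y ⟩
  (1 + d) * x + d * (2 + d) * y     ∎
  where
  open ≤-Reasoning
  x = X d n
  y = Y d n
  expand : ∀ d x y → x + d * (x + (1 + d) * y) + d * y ≡ (1 + d) * x + d * (2 + d) * y
  expand = solve-∀

Y-suc-lower : ∀ d n → (1 + 2 * d) * Y d n ≤ Y d (suc n)
Y-suc-lower d n = begin
  (1 + 2 * d) * y       ≡⟨ expand d y ⟩
  d * y + (1 + d) * y   ≤⟨ +-monoˡ-≤ ((1 + d) * y) (<⇒≤ (dY<X d n)) ⟩
  X d n + (1 + d) * y   ∎
  where
  open ≤-Reasoning
  y = Y d n
  expand : ∀ d y → (1 + 2 * d) * y ≡ d * y + (1 + d) * y
  expand = solve-∀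

X-suc-upper : ∀ d n → X d (suc n) ≤ (1 + d) * Y d (suc n)
X-suc-upper d n = begin
  (1 + d) * x + d * (2 + d) * y       ≤⟨ m≤m+n _ y ⟩
  (1 + d) * x + d * (2 + d) * y + y   ≡⟨ expand d x y ⟩
  (1 + d) * (x + (1 + d) * y)         ∎
  where
  open ≤-Reasoning
  x = X d n
  y = Y d n
  expand : ∀ d x y → (1 + d) * x + d * (2 + d) * y + y ≡ (1 + d) * (x + (1 + d) * y)
  expand = solve-∀

-- Consecutive terms have the ratio `1 + d + X / Y`. As `d Y < X ≤ (1 + d) Y` from index one on, it
-- lies between `1 + 2d` and `2 + 2d`.
Y-lower : ∀ d n → (1 + 2 * d) ^ n ≤ Y d (suc n)
Y-lower d zero    = ≤-trans (1≤X d 0) (m≤m+n _ _)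
Y-lower d (suc n) = ≤-trans (*-monoʳ-≤ (1 + 2 * d) (Y-lower d n)) (Y-suc-lower d (suc n))

Y-upper : ∀ d n → Y d (suc n) ≤ (2 * (1 + d)) ^ n
Y-upper d zero    = ≤-reflexive (cong (λ z → 1 + z) (*-zeroʳ (1 + d)))
Y-upper d (suc n) = begin
  X d (suc n) + (1 + d) * y   ≤⟨ +-monoˡ-≤ ((1 + d) * y) (X-suc-upper d n) ⟩
  (1 + d) * y + (1 + d) * y   ≡⟨ double (1 + d) y ⟩
  2 * (1 + d) * y             ≤⟨ *-monoʳ-≤ (2 * (1 + d)) (Y-upper d n) ⟩
  (2 * (1 + d)) ^ suc n       ∎
  where
  open ≤-Reasoning
  y = Y d (suc n)
  double : ∀ a y → a * y + a * y ≡ 2 * a * y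
  double = solve-∀

Y<Y-suc : ∀ d n → Y d n < Y d (suc n)
Y<Y-suc d n = <-≤-trans (m<n+m (Y d n) (1≤X d n)) (+-monoʳ-≤ (X d n) (m≤m+n (Y d n) (d * Y d n)))

Y-mono-< : ∀ d {m n} → m < n → Y d m < Y d n
Y-mono-< d {m} {suc n} (s≤s m≤n) with m≤n⇒m<n∨m≡n m≤n
... | inj₁ m<n  = <-trans (Y-mono-< d m<n) (Y<Y-suc d n)
... | inj₂ refl = Y<Y-suc d n

Y-mono-≤ : ∀ d {m n} → m ≤ n → Y d m ≤ Y d n
Y-mono-≤ d m≤n with m≤n⇒m<n∨m≡n m≤n
... | inj₁ m<n  = <⇒≤ (Y-mono-< d m<n)
... | inj₂ refl = ≤-refl

Y-injective : ∀ d {m n} → Y d m ≡ Y d n → m ≡ n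
Y-injective d {m} {n} e with <-cmp m n
... | tri< m<n _ _ = contradiction e (<⇒≢ (Y-mono-< d m<n))
... | tri≈ _ m≡n _ = m≡n
... | tri> _ _ n<m = contradiction (sym e) (<⇒≢ (Y-mono-< d n<m))

n≤Y : ∀ d n → n ≤ Y d n
n≤Y d zero    = z≤n
n≤Y d (suc n) = ≤-<-trans (n≤Y d n) (Y<Y-suc d n)

0<Y⇒0<n : ∀ d n → 0 < Y d n → 0 < n
0<Y⇒0<n d (suc n) _ = z<s

X-cong : ∀ d w n → ∃₂ λ k l → X (d + w) n ≡ X d n + w * k × Y (d + w) n ≡ Y d n + w * l
X-cong d w zero = 0 , 0 , cong suc (sym (*-zeroʳ w)) , sym (*-zeroʳ w)
X-cong d w (suc n) with X-cong d w n
... | k , l , eˣ , eʸ =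
  _ , _ ,
  trans (cong₂ (λ p q → (1 + (d + w)) * p + Δ (d + w) * q) eˣ eʸ) (step₁ d w (X d n) (Y d n) k l) ,
  trans (cong₂ (λ p q → p + (1 + (d + w)) * q) eˣ eʸ) (step₂ d w (X d n) (Y d n) k l)
  where
  step₁ : ∀ d w x y k l →
    (1 + (d + w)) * (x + w * k) + (d + w) * (2 + (d + w)) * (y + w * l)
    ≡ (1 + d) * x + d * (2 + d) * y
      + w * (x + w * k + (1 + d) * k + (2 + 2 * d + w) * (y + w * l) + d * (2 + d) * l)
  step₁ = solve-∀
  step₂ : ∀ d w x y k l →
    x + w * k + (1 + (d + w)) * (y + w * l)
    ≡ x + (1 + d) * y + w * (k + (1 + d) * l + (y + w * l))
  step₂ = solve-∀

Y-cong : ∀ d w n → ∃ λ k → Y (d + w) n ≡ Y d n + w * k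
Y-cong d w n with X-cong d w n
... | _ , l , _ , e = l , e

-- At `d = 0` the unit degenerates to a linear recurrence. Shifting the parameter from `0` to `d`
-- then gives `Y d n ≡ n` modulo `d`.
Y-zero : ∀ n → X 0 n ≡ 1 × Y 0 n ≡ n
Y-zero zero = refl , refl
Y-zero (suc n) with Y-zero n
... | eˣ , eʸ = trans (+-identityʳ _) (trans (+-identityʳ _) eˣ) ,
                cong₂ _+_ eˣ (trans (+-identityʳ _) eʸ)

Y≡n+d* : ∀ d n → ∃ λ k → Y d n ≡ n + d * k
Y≡n+d* d n with Y-cong 0 d n
... | k , e = k , trans e (cong (_+ d * k) (proj₂ (Y-zero n)))

-- All solutions of the Pell equation

square-cancel-< : ∀ {m n} → m * m < n * n → m < n
square-cancel-< {m} {n} m²<n² with m <? n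
... | yes m<n = m<n
... | no  m≮n = contradiction (*-mono-≤ (≮⇒≥ m≮n) (≮⇒≥ m≮n)) (<⇒≱ m²<n²)

square-cancel-≤ : ∀ {m n} → m * m ≤ n * n → m ≤ n
square-cancel-≤ {m} {n} m²≤n² with m ≤? n
... | yes m≤n = m≤n
... | no  m≰n = contradiction (*-mono-< (≰⇒> m≰n) (≰⇒> m≰n)) (≤⇒≯ m²≤n²)

-- Multiplication by the inverse of the unit 1 + d + √Δ decreases y.
pell-descent : ∀ d x y → 0 < y → x * x ≡ Δ d * (y * y) + 1 →
  ∃₂ λ x′ y′ → y′ < y × x′ * x′ ≡ Δ d * (y′ * y′) + 1
             × x ≡ (1 + d) * x′ + Δ d * y′ × y ≡ x′ + (1 + d) * y′
pell-descent d x y 0<y e = x′ , y′ , y′<y , pell′ , x≡ , sym y≡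
  where
  a = 1 + d
  x≤ay : x ≤ a * y
  x≤ay = square-cancel-≤ (begin
    x * x                  ≡⟨ e ⟩
    Δ d * (y * y) + 1      ≤⟨ +-monoʳ-≤ (Δ d * (y * y)) (*-mono-≤ 0<y 0<y) ⟩
    Δ d * (y * y) + y * y  ≡⟨ expand d y ⟩
    a * y * (a * y)        ∎)
    where
    open ≤-Reasoning
    expand : ∀ d y → d * (2 + d) * (y * y) + y * y ≡ (1 + d) * y * ((1 + d) * y)
    expand = solve-∀
  y′ = a * y ∸ x
  x+y′ : x + y′ ≡ a * y
  x+y′ = m+[n∸m]≡n x≤ay
  y²₁ : 1 + 2 * (x * y′) + y′ * y′ ≡ y * y
  y²₁ = +-cancelˡ-≡ (Δ d * (y * y)) _ _ (begin
    Δ d * (y * y) + (1 + 2 * (x * y′) + y′ * y′)   ≡⟨ assoc (Δ d * (y * y)) (2 * (x * y′)) (y′ * y′) ⟩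
    (Δ d * (y * y) + 1) + 2 * (x * y′) + y′ * y′   ≡⟨ cong (λ z → z + 2 * (x * y′) + y′ * y′) e ⟨
    x * x + 2 * (x * y′) + y′ * y′                 ≡⟨ binomial x y′ ⟩
    (x + y′) * (x + y′)                            ≡⟨ cong₂ _*_ x+y′ x+y′ ⟩
    (a * y) * (a * y)                              ≡⟨ expand d y ⟩
    Δ d * (y * y) + y * y                          ∎)
    where
    open ≡-Reasoning
    assoc : ∀ u v w → u + (1 + v + w) ≡ (u + 1) + v + w
    assoc = solve-∀
    binomial : ∀ x y → x * x + 2 * (x * y) + y * y ≡ (x + y) * (x + y)
    binomial = solve-∀
    expand : ∀ d y → (1 + d) * y * ((1 + d) * y) ≡ d * (2 + d) * (y * y) + y * y
    expand = solve-∀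
  y′<y : y′ < y
  y′<y = square-cancel-< (≤-trans (s≤s (m≤n+m (y′ * y′) (2 * (x * y′)))) (≤-reflexive y²₁))
  -- The invariant `y² - 2 a y y′ + y′² = 1` of consecutive terms. It bounds `a y′` by `y` and,
  -- after substituting `y = x′ + a y′`, becomes the Pell equation for `x′` and `y′`.
  y²₂ : 1 + 2 * (a * y * y′) ≡ y * y + y′ * y′
  y²₂ = begin
    1 + 2 * (a * y * y′)                        ≡⟨ cong (λ z → 1 + 2 * (z * y′)) x+y′ ⟨
    1 + 2 * ((x + y′) * y′)                     ≡⟨ expand x y′ ⟩
    1 + 2 * (x * y′) + y′ * y′ + y′ * y′        ≡⟨ cong (_+ y′ * y′) y²₁ ⟩
    y * y + y′ * y′                             ∎
    where
    open ≡-Reasoning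
    expand : ∀ x y → 1 + 2 * ((x + y) * y) ≡ 1 + 2 * (x * y) + y * y + y * y
    expand = solve-∀
  ay′≤y : a * y′ ≤ y
  ay′≤y = ≮⇒≥ λ y<ay′ → <-irrefl (sym y²₂) (begin-strict
    y * y + y′ * y′                  ≤⟨ +-monoʳ-≤ (y * y) (*-mono-≤ (<⇒≤ y′<y) (<⇒≤ y′<y)) ⟩
    y * y + y * y                    ≤⟨ +-mono-≤ (*-monoˡ-≤ y (<⇒≤ y<ay′)) (*-monoˡ-≤ y (<⇒≤ y<ay′)) ⟩
    (a * y′) * y + (a * y′) * y      <⟨ n<1+n _ ⟩
    1 + ((a * y′) * y + (a * y′) * y) ≡⟨ comm a y y′ ⟩
    1 + 2 * (a * y * y′)             ∎)
    where
    open ≤-Reasoning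
    comm : ∀ a y z → 1 + ((a * z) * y + (a * z) * y) ≡ 1 + 2 * (a * y * z)
    comm = solve-∀
  x′ = y ∸ a * y′
  y≡ : x′ + a * y′ ≡ y
  y≡ = trans (+-comm x′ (a * y′)) (m+[n∸m]≡n ay′≤y)
  x≡ : x ≡ a * x′ + Δ d * y′
  x≡ = +-cancelʳ-≡ y′ _ _ (begin
    x + y′                      ≡⟨ x+y′ ⟩
    a * y                       ≡⟨ cong (a *_) y≡ ⟨
    a * (x′ + a * y′)           ≡⟨ expand d x′ y′ ⟩
    a * x′ + Δ d * y′ + y′      ∎)
    where
    open ≡-Reasoning
    expand : ∀ d x y → (1 + d) * (x + (1 + d) * y) ≡ (1 + d) * x + d * (2 + d) * y + y
    expand = solve-∀
  pell′ : x′ * x′ ≡ Δ d * (y′ * y′) + 1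
  pell′ = +-cancelʳ-≡ (2 * (a * x′ * y′) + a * a * (y′ * y′) + y′ * y′) _ _ (begin
    x′ * x′ + (2 * (a * x′ * y′) + a * a * (y′ * y′) + y′ * y′)   ≡⟨ binomial d x′ y′ ⟩
    (x′ + a * y′) * (x′ + a * y′) + y′ * y′                       ≡⟨ cong (λ z → z * z + y′ * y′) y≡ ⟩
    y * y + y′ * y′                                               ≡⟨ y²₂ ⟨
    1 + 2 * (a * y * y′)                                          ≡⟨ cong (λ z → 1 + 2 * (a * z * y′)) y≡ ⟨
    1 + 2 * (a * (x′ + a * y′) * y′)                              ≡⟨ expand d x′ y′ ⟩
    Δ d * (y′ * y′) + 1 + (2 * (a * x′ * y′) + a * a * (y′ * y′) + y′ * y′)  ∎)
    where
    open ≡-Reasoning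
    binomial : ∀ d x y → x * x + (2 * ((1 + d) * x * y) + (1 + d) * (1 + d) * (y * y) + y * y)
                       ≡ (x + (1 + d) * y) * (x + (1 + d) * y) + y * y
    binomial = solve-∀
    expand : ∀ d x y → 1 + 2 * ((1 + d) * (x + (1 + d) * y) * y)
                     ≡ d * (2 + d) * (y * y) + 1 + (2 * ((1 + d) * x * y) + (1 + d) * (1 + d) * (y * y) + y * y)
    expand = solve-∀

pell-complete : ∀ d x y → x * x ≡ Δ d * (y * y) + 1 → ∃ λ n → x ≡ X d n × y ≡ Y d n
pell-complete d x y = <-rec P step y x
  where
  P : ℕ → Set
  P y = ∀ x → x * x ≡ Δ d * (y * y) + 1 → ∃ λ n → x ≡ X d n × y ≡ Y d n
  step : ∀ y → (∀ {y′} → y′ < y → P y′) → P y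
  step zero rec x e = 0 , m*n≡1⇒m≡1 x x (trans e (cong (_+ 1) (*-zeroʳ (Δ d)))) , refl
  step y@(suc _) rec x e =
    let x′ , y′ , y′<y , e′ , x≡ , y≡ = pell-descent d x y z<s e
        n , eˣ , eʸ = rec y′<y x′ e′
    in suc n , trans x≡ (cong₂ (λ u v → (1 + d) * u + Δ d * v) eˣ eʸ) ,
       trans y≡ (cong₂ (λ u v → u + (1 + d) * v) eˣ eʸ)

square⇒Y : ∀ d y → Square (Δ d * (y * y) + 1) → ∃ λ n → y ≡ Y d n
square⇒Y d y (r , e) with pell-complete d r y e
... | n , _ , y≡ = n , y≡

-- Divisibility between Pell numbers

coprime-1+ : ∀ {a b m} → a ∣ m → b ≡ m + 1 → Coprime a b
coprime-1+ {m = m} a∣m refl (d∣a , d∣b) = ∣1⇒≡1 (∣m+n∣m⇒∣n d∣b (∣-trans d∣a a∣m))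

coprime-cancel-^ : ∀ {c x} j k → Coprime c x → c ∣ k * x ^ j → c ∣ k
coprime-cancel-^ {c} zero k cop c∣ = subst (c ∣_) (*-identityʳ k) c∣
coprime-cancel-^ {c} {x} (suc j) k cop c∣ =
  coprime-cancel-^ j k cop (coprime-divisor cop (subst (c ∣_) (comm k x (x ^ j)) c∣))
  where
  comm : ∀ k x p → k * (x * p) ≡ x * (k * p)
  comm = solve-∀

Y-X-coprime : ∀ d n {c} → c ∣ Y d n → Coprime c (X d n)
Y-X-coprime d n {c} c∣Y {e} (e∣c , e∣X) = ∣1⇒≡1 (∣m+n∣m⇒∣n
  (subst (e ∣_) (pell d n) (∣m⇒∣m*n (X d n) e∣X))
  (∣n⇒∣m*n (Δ d) (∣m⇒∣m*n (Y d n) (∣-trans e∣c c∣Y))))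

Y∣Y-* : ∀ d p k → Y d p ∣ Y d (k * p)
Y∣Y-* d p zero    = _ ∣0
Y∣Y-* d p (suc k) = subst (Y d p ∣_) (sym (Y-+ d p (k * p)))
  (∣m∣n⇒∣m+n (∣n⇒∣m*n (X d p) (Y∣Y-* d p k)) (m∣m*n (X d (k * p))))

-- Expansion of (X + Y√Δ)ᵏ modulo Y²; the factor X avoids the exponent k − 1.
XY-* : ∀ d p k → ∃₂ λ α β →
    X d (k * p) ≡ X d p ^ k + Y d p * Y d p * α
  × X d p * Y d (k * p) ≡ k * X d p ^ k * Y d p + Y d p * Y d p * β
XY-* d p zero = 0 , 0 , base (Y d p) , base₀ (X d p) (Y d p)
  where
  base : ∀ y → 1 ≡ 1 + y * y * 0
  base = solve-∀
  base₀ : ∀ x y → x * 0 ≡ 0 * 1 * y + y * y * 0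
  base₀ = solve-∀
XY-* d p (suc k) with XY-* d p k | Y∣Y-* d p k
... | α , β , eˣ , eʸ | divides γ eγ = _ , _ , stepˣ , stepʸ
  where
  open ≡-Reasoning
  x = X d p
  y = Y d p
  stepˣ : X d (p + k * p) ≡ x ^ suc k + y * y * (x * α + Δ d * γ)
  stepˣ = begin
    X d (p + k * p)                                ≡⟨ X-+ d p (k * p) ⟩
    x * X d (k * p) + Δ d * (y * Y d (k * p))      ≡⟨ cong₂ (λ u v → x * u + Δ d * (y * v)) eˣ eγ ⟩
    x * (x ^ k + y * y * α) + Δ d * (y * (γ * y))  ≡⟨ expand x y (x ^ k) (Δ d) α γ ⟩
    x ^ suc k + y * y * (x * α + Δ d * γ)          ∎
    where
    expand : ∀ x y q e α γ → x * (q + y * y * α) + e * (y * (γ * y)) ≡ x * q + y * y * (x * α + e * γ)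
    expand = solve-∀
  stepʸ : x * Y d (p + k * p) ≡ suc k * x ^ suc k * y + y * y * (x * β + x * y * α)
  stepʸ = begin
    x * Y d (p + k * p)                                 ≡⟨ cong (x *_) (Y-+ d p (k * p)) ⟩
    x * (x * Y d (k * p) + y * X d (k * p))             ≡⟨ cong₂ (λ u v → x * (u + y * v)) eʸ eˣ ⟩
    x * (k * x ^ k * y + y * y * β + y * (x ^ k + y * y * α))  ≡⟨ expand x y (x ^ k) k α β ⟩
    suc k * x ^ suc k * y + y * y * (x * β + x * y * α) ∎
    where
    expand : ∀ x y q k α β → x * (k * q * y + y * y * β + y * (q + y * y * α))
                           ≡ (1 + k) * (x * q) * y + y * y * (x * β + x * y * α)
    expand = solve-∀

-- Write `n = k p + r`. Modulo `Y d p` only `X d (k p) Y d r` survives, and its first factor is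
-- coprime to `Y d p`. So `Y d p` divides `Y d r` with `r < p`, which leaves `r = 0`.
Y∣Y⇒∣ : ∀ d p n → 0 < p → Y d p ∣ Y d n → p ∣ n
Y∣Y⇒∣ d p@(suc _) n _ y∣ = subst (p ∣_) (sym n≡) (n∣m*n k)
  where
  k = n / p
  r = n % p
  y∣′ : Y d p ∣ X d (k * p) * Y d r + Y d (k * p) * X d r
  y∣′ = subst (Y d p ∣_) (trans (cong (Y d) (trans (m≡m%n+[m/n]*n n p) (+-comm r (k * p)))) (Y-+ d (k * p) r)) y∣
  y∣Yr : Y d p ∣ Y d r
  y∣Yr = coprime-divisor (Y-X-coprime d (k * p) (Y∣Y-* d p k))
    (∣m+n∣m⇒∣n (subst (Y d p ∣_) (+-comm (X d (k * p) * Y d r) _) y∣′) (∣m⇒∣m*n (X d r) (Y∣Y-* d p k)))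
  r≡0 : r ≡ 0
  r≡0 with r in eq
  ... | zero  = refl
  ... | suc r′ = contradiction (∣⇒≤ {{>-nonZero (≤-trans z<s (n≤Y d (suc r′)))}} (subst (λ z → Y d p ∣ Y d z) eq y∣Yr))
                  (<⇒≱ (Y-mono-< d (subst (_< p) eq (m%n<n n p))))
  n≡ : n ≡ k * p
  n≡ = trans (m≡m%n+[m/n]*n n p) (cong (_+ k * p) r≡0)

-- With `n = k p`, the expansion `XY-*` leaves `k X^k Y` modulo `Y²`. Cancelling one `Y` and the
-- powers of `X`, which are coprime to `Y`, gives `Y d p ∣ k`.
Y²∣Y⇒Y∣ : ∀ d p n → 0 < p → Y d p * Y d p ∣ Y d n → Y d p ∣ n
Y²∣Y⇒Y∣ d p n 0<p y²∣ with Y∣Y⇒∣ d p n 0<p (∣-trans (m∣m*n (Y d p)) y²∣)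
... | divides k refl with XY-* d p k
...   | _ , β , _ , eʸ = ∣m⇒∣m*n p (coprime-cancel-^ k k (Y-X-coprime d p ∣-refl)
          (*-cancelʳ-∣ y {{>-nonZero (≤-trans 0<p (n≤Y d p))}} y²∣kxᵏy))
  where
  y = Y d p
  y²∣kxᵏy : y * y ∣ k * X d p ^ k * y
  y²∣kxᵏy = ∣m+n∣m⇒∣n (subst (y * y ∣_) (trans eʸ (+-comm (k * X d p ^ k * y) _)) (∣n⇒∣m*n (X d p) y²∣)) (m∣m*n β)

%-≡⇒≈ : ∀ {a b} m .{{_ : NonZero m}} → a % m ≡ b % m → a ≈ b [mod m ]
%-≡⇒≈ {a} {b} m e = witness {left = b / m} {a / m} (begin
  a + m * (b / m)                    ≡⟨ cong (_+ m * (b / m)) (m≡m%n+[m/n]*n a m) ⟩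
  a % m + a / m * m + m * (b / m)    ≡⟨ cong (λ z → z + a / m * m + m * (b / m)) e ⟩
  b % m + a / m * m + m * (b / m)    ≡⟨ rearrange (b % m) (a / m) (b / m) m ⟩
  b % m + b / m * m + m * (a / m)    ≡⟨ cong (_+ m * (a / m)) (m≡m%n+[m/n]*n b m) ⟨
  b + m * (a / m)                    ∎)
  where
  open ≡-Reasoning
  rearrange : ∀ r p q m → r + p * m + m * q ≡ r + q * m + m * p
  rearrange = solve-∀

-- Two indices with equal residues of (X , Y) differ by an index whose Y is divisible by B.
Y-multiple : ∀ d B → 0 < B → ∃ λ n → 0 < n × B ∣ Y d n
Y-multiple d B@(suc _) _ = conclude (pigeonhole (n<1+n (B * B)) residues)
  where
  res : ℕ → Fin B
  res a = fromℕ< (m%n<n a B)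
  res-injective : ∀ {a b} → res a ≡ res b → a ≈ b [mod B ]
  res-injective {a} {b} e = %-≡⇒≈ B (fromℕ<-injective (a % B) (b % B) (m%n<n a B) (m%n<n b B) e)
  residues : Fin (suc (B * B)) → Fin (B * B)
  residues i = combine (res (X d (toℕ i))) (res (Y d (toℕ i)))
  -- The subtraction formula expresses `Y d k` as `Y d (i + k) X d i - X d (i + k) Y d i`, whose two
  -- products agree modulo `B`.
  differ : ∀ i k → X d (i + k) ≈ X d i [mod B ] → Y d (i + k) ≈ Y d i [mod B ] → B ∣ Y d k
  differ i k (witness {p} {q} eˣ) (witness {r} {s} eʸ) = ∣m+n∣m⇒∣n {B} {B * (r * X d i + q * Y d i)}
    (subst (B ∣_) key (m∣m*n (s * X d i + p * Y d i))) (m∣m*n _)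
    where
    open ≡-Reasoning
    x = X d i
    y = Y d i
    x′ = X d (i + k)
    y′ = Y d (i + k)
    key : B * (s * x + p * y) ≡ B * (r * x + q * y) + Y d k
    key = +-cancelˡ-≡ (x * y + x′ * y) _ _ (begin
      x * y + x′ * y + B * (s * x + p * y)             ≡⟨ split₁ x y x′ s p B ⟩
      (y + B * s) * x + (x′ + B * p) * y               ≡⟨ cong₂ (λ u v → u * x + v * y) (sym eʸ) eˣ ⟩
      (y′ + B * r) * x + (x + B * q) * y               ≡⟨ split₂ x y y′ r q B ⟩
      y′ * x + (x * y + B * (r * x + q * y))           ≡⟨ cong (_+ (x * y + B * (r * x + q * y))) (Y-∸ d i k) ⟩
      Y d k + x′ * y + (x * y + B * (r * x + q * y))   ≡⟨ move (Y d k) (x′ * y) (x * y) (B * (r * x + q * y)) ⟩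
      x * y + x′ * y + (B * (r * x + q * y) + Y d k)   ∎)
      where
      split₁ : ∀ x y x′ s p B → x * y + x′ * y + B * (s * x + p * y) ≡ (y + B * s) * x + (x′ + B * p) * y
      split₁ = solve-∀
      split₂ : ∀ x y y′ r q B → (y′ + B * r) * x + (x + B * q) * y ≡ y′ * x + (x * y + B * (r * x + q * y))
      split₂ = solve-∀
      move : ∀ a b c e → a + b + (c + e) ≡ c + b + (e + a)
      move = solve-∀
  conclude : (∃₂ λ i j → toℕ i < toℕ j × residues i ≡ residues j) → ∃ λ n → 0 < n × B ∣ Y d n
  conclude (i , j , i<j , e) = toℕ j ∸ toℕ i , m<n⇒0<n∸m i<j , differ (toℕ i) _
      (subst (λ z → X d z ≈ X d (toℕ i) [mod B ]) (sym j≡) (≈-sym (res-injective (proj₁ e′))))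
      (subst (λ z → Y d z ≈ Y d (toℕ i) [mod B ]) (sym j≡) (≈-sym (res-injective (proj₂ e′))))
    where
    j≡ : toℕ i + (toℕ j ∸ toℕ i) ≡ toℕ j
    j≡ = m+[n∸m]≡n (<⇒≤ i<j)
    e′ = combine-injective (res (X d (toℕ i))) (res (Y d (toℕ i))) (res (X d (toℕ j))) (res (Y d (toℕ j))) e

-- Recovering an index from a residue modulo `X d m`

-- Modulo `X d m` the square of the `m`-th power of the unit is `-1`, so a shift by `2m` changes the
-- sign.
Y-half-period : ∀ d m r → X d m ∣ Y d (m + m + r) + Y d r
Y-half-period d m r = divides (2 * (X d m * Y d r + Y d m * X d r)) (begin
  Y d (m + m + r) + v                                        ≡⟨ cong (_+ v) (Y-+ d (m + m) r) ⟩
  X d (m + m) * v + Y d (m + m) * u + v                      ≡⟨ cong₂ (λ p q → p * v + q * u + v) (X-+ d m m) (Y-+ d m m) ⟩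
  (x * x + Δ d * (y * y)) * v + (x * y + y * x) * u + v      ≡⟨ regroup (x * x) (Δ d * (y * y)) v ((x * y + y * x) * u) ⟩
  x * x * v + (Δ d * (y * y) + 1) * v + (x * y + y * x) * u  ≡⟨ cong (λ z → x * x * v + z * v + (x * y + y * x) * u) (sym (pell d m)) ⟩
  x * x * v + x * x * v + (x * y + y * x) * u                ≡⟨ collect x y u v ⟩
  2 * (x * v + y * u) * x                                    ∎)
  where
  open ≡-Reasoning
  x = X d m
  y = Y d m
  u = X d r
  v = Y d r
  regroup : ∀ a b v c → (a + b) * v + c + v ≡ a * v + (b + 1) * v + c
  regroup = solve-∀
  collect : ∀ x y u v → x * x * v + x * x * v + (x * y + y * x) * u ≡ 2 * (x * v + y * u) * x
  collect = solve-∀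

-- With `m = q + r` this is `Y (m + q) - Y (m - q) = 2 X m Y q`: modulo `X d m` the sequence is
-- symmetric about `m`.
Y-reflect : ∀ d q r → Y d ((q + r) + q) ≡ Y d r + X d (q + r) * (2 * Y d q)
Y-reflect d q r = begin
  Y d (q + r + q)                                     ≡⟨ Y-+ d (q + r) q ⟩
  X d (q + r) * Y d q + Y d (q + r) * X d q           ≡⟨ cong (λ z → X d (q + r) * Y d q + z) (Y-∸ d q r) ⟩
  X d (q + r) * Y d q + (Y d r + X d (q + r) * Y d q) ≡⟨ collect (X d (q + r)) (Y d q) (Y d r) ⟩
  Y d r + X d (q + r) * (2 * Y d q)                   ∎
  where
  open ≡-Reasoning
  collect : ∀ x y v → x * y + (v + x * y) ≡ v + x * (2 * y)
  collect = solve-∀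

-- Shifts by `2m` reverse the sign and reflection at `m` preserves it, so every index folds into the
-- range from `0` to `m`.
step-down : ∀ d m → 0 < m → ∀ n →
  ∃ λ r → r ≤ m × n ≈± r [mod m + m ] × Y d n ≈± Y d r [mod X d m ]
step-down d m 0<m = <-rec _ step
  where
  P : ℕ → Set
  P n = ∃ λ r → r ≤ m × n ≈± r [mod m + m ] × Y d n ≈± Y d r [mod X d m ]
  step : ∀ n → (∀ {k} → k < n → P k) → P n
  step n rec with n ≤? m
  ... | yes n≤m = n , n≤m , same ≈-refl , same ≈-refl
  ... | no n≰m with n ≤? m + m
  ...   | yes n≤2m = r , m∸n≤m m q , opposite 2m∣ , same Y≈
    where
    q = n ∸ m
    m+q≡n : m + q ≡ n
    m+q≡n = m+[n∸m]≡n (≰⇒≥ n≰m)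
    r = m ∸ q
    q+r≡m : q + r ≡ m
    q+r≡m = m+[n∸m]≡n (m≤n+o⇒m∸n≤o n m n≤2m)
    2m∣ : m + m ∣ n + r
    2m∣ = ∣-reflexive (sym (trans (cong (_+ r) (sym m+q≡n)) (trans (+-assoc m q r) (cong (λ z → m + z) q+r≡m))))
    Y≈ : Y d n ≈ Y d r [mod X d m ]
    Y≈ = witness {left = 0} {2 * Y d q} (begin
      Y d n + X d m * 0                    ≡⟨ trans (cong (λ z → Y d n + z) (*-zeroʳ (X d m))) (+-identityʳ _) ⟩
      Y d n                                ≡⟨ cong (Y d) (trans (sym m+q≡n) (cong (_+ q) (sym q+r≡m))) ⟩
      Y d (q + r + q)                      ≡⟨ Y-reflect d q r ⟩
      Y d r + X d (q + r) * (2 * Y d q)    ≡⟨ cong (λ z → Y d r + X d z * (2 * Y d q)) q+r≡m ⟩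
      Y d r + X d m * (2 * Y d q)          ∎)
      where open ≡-Reasoning
  ...   | no n≰2m with rec {n ∸ (m + m)} (∸-monoʳ-< {n} (<-≤-trans 0<m (m≤m+n m m)) (≰⇒≥ n≰2m))
  ...     | r , r≤m , n′≈r , Y≈ = r , r≤m , ≈±-trans (same n≈n′) n′≈r , ≈±-trans (opposite Y∣) Y≈
    where
    n′ = n ∸ (m + m)
    n≡ : (m + m) + n′ ≡ n
    n≡ = m+[n∸m]≡n (≰⇒≥ n≰2m)
    n≈n′ : n ≈ n′ [mod m + m ]
    n≈n′ = witness {left = 0} {1} (trans (trans (cong₂ _+_ (sym n≡) (*-zeroʳ (m + m))) (+-identityʳ _))
             (trans (+-comm (m + m) n′) (cong (λ z → n′ + z) (sym (*-identityʳ (m + m))))))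
    Y∣ : X d m ∣ Y d n + Y d n′
    Y∣ = subst (λ z → X d m ∣ Y d z + Y d n′) n≡ (Y-half-period d m n′)

2Y<X : ∀ d m → 2 ≤ d → Y d m + Y d m < X d m
2Y<X d m 2≤d = ≤-<-trans (≤-trans (≤-reflexive (cong (λ z → Y d m + z) (sym (+-identityʳ (Y d m))))) (*-monoˡ-≤ (Y d m) 2≤d)) (dY<X d m)

-- On indices up to `m` the values satisfy `2 Y < X d m`, which is where `2 ≤ d` enters. Equal
-- residues there mean equal values, and opposite residues would need a positive sum below `X d m`
-- to be divisible by it.
Y≈±⇒index≈± : ∀ d m n p → 2 ≤ d → 0 < m → 0 < p → p ≤ m →
  Y d n ≈± Y d p [mod X d m ] → n ≈± p [mod m + m ]
Y≈±⇒index≈± d m n p 2≤d 0<m 0<p p≤m Yn≈Yp with step-down d m 0<m n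
... | r , r≤m , n≈r , Yn≈Yr = subst (λ z → n ≈± z [mod m + m ]) r≡p n≈r
  where
  Y<X : ∀ {k} → k ≤ m → Y d k < X d m
  Y<X k≤m = ≤-<-trans (≤-trans (Y-mono-≤ d k≤m) (m≤m+n _ _)) (2Y<X d m 2≤d)
  r≡p : r ≡ p
  r≡p with ≈±-trans (≈±-sym Yn≈Yr) Yn≈Yp
  ... | same Yr≈Yp = Y-injective d (≈-<-≡ Yr≈Yp (Y<X r≤m) (Y<X p≤m))
  ... | opposite X∣ = contradiction (∣⇒≤ {{>-nonZero 0<s}} X∣)
          (<⇒≱ (≤-<-trans (+-mono-≤ (Y-mono-≤ d r≤m) (Y-mono-≤ d p≤m)) (2Y<X d m 2≤d)))
    where
    0<s : 0 < Y d r + Y d p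
    0<s = <-≤-trans (<-≤-trans 0<p (n≤Y d p)) (m≤n+m (Y d p) (Y d r))

-- In the opposite case `a + b ≥ 2k`, so both numbers are `k`.
≈±-half-≡ : ∀ {a b k} → 0 < a → 0 < b → a ≤ k → b ≤ k → a ≈± b [mod k + k ] → a ≡ b
≈±-half-≡ {a} {b} {k} 0<a 0<b a≤k b≤k (same a≈b) =
  ≈-<-≡ a≈b (k< a≤k) (k< b≤k)
  where
  k< : ∀ {c} → c ≤ k → c < k + k
  k< c≤k = ≤-<-trans c≤k (m<m+n k (<-≤-trans 0<a a≤k))
≈±-half-≡ {a} {b} {k} 0<a 0<b a≤k b≤k (opposite 2k∣) =
  trans (top a≤k (≤-trans 2k≤ (+-monoʳ-≤ a b≤k)))
        (sym (top b≤k (≤-trans (≤-trans 2k≤ (+-monoˡ-≤ b a≤k)) (≤-reflexive (+-comm k b)))))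
  where
  2k≤ : k + k ≤ a + b
  2k≤ = ∣⇒≤ {{>-nonZero (<-≤-trans 0<a (m≤m+n a b))}} 2k∣
  top : ∀ {c} → c ≤ k → k + k ≤ c + k → c ≡ k
  top c≤k 2k≤c+k = ≤-antisym c≤k (+-cancelʳ-≤ k k _ 2k≤c+k)

≡+*⇒≈ : ∀ {a b m k} → a ≡ b + m * k → a ≈ b [mod m ]
≡+*⇒≈ {a} {b} {m} {k} e = witness {left = 0} {k} (trans (cong (λ z → a + z) (*-zeroʳ m)) (trans (+-identityʳ a) e))

-- Matiyasevich's criterion

-- Modulo `F`, hence modulo `X d m`, `Y d n ≡ t ≡ Y d p`, so `n ≡ ±p` modulo `2m`. As `K² ∣ E`
-- forces `K ∣ m`, this descends to the modulus `2K`, where also `c ≡ t ≡ n`. Both `c` and `p` lie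
-- between `1` and `K`, so the sign ambiguity disappears.
Y-index-determined : ∀ d w p m n c →
  let K = Y d p
      E = Y d m
      F = Δ d * (E * E) + 1
      t = Y (d + F * w) n
  in 2 ≤ d → 0 < p → 0 < m → K * K ∣ E → K + K ∣ d + F * w →
     t ≈ K [mod F ] → t ≈ c [mod K + K ] → 0 < c → c ≤ K → c ≡ p
Y-index-determined d w p m n c 2≤d 0<p 0<m K²∣E 2K∣b t≈K t≈c 0<c c≤K =
  ≈±-half-≡ 0<c 0<p c≤K (n≤Y d p)
    (≈±-trans (same (≈-trans (≈-sym t≈c) t≈n)) (≈±-∣ 2K∣2m (Y≈±⇒index≈± d m n p 2≤d 0<m 0<p p≤m (same Yn≈K))))
  where
  K = Y d p
  E = Y d m
  F = Δ d * (E * E) + 1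
  K∣m : K ∣ m
  K∣m = Y²∣Y⇒Y∣ d p m 0<p K²∣E
  p≤m : p ≤ m
  p≤m = ≤-trans (n≤Y d p) (∣⇒≤ {{>-nonZero 0<m}} K∣m)
  2K∣2m : K + K ∣ m + m
  2K∣2m = subst₂ _∣_ (double K) (double m) (*-monoʳ-∣ 2 K∣m)
    where
    double : ∀ k → 2 * k ≡ k + k
    double = solve-∀
  t≈n : Y (d + F * w) n ≈ n [mod K + K ]
  t≈n = ≈-∣ 2K∣b (≡+*⇒≈ (proj₂ (Y≡n+d* (d + F * w) n)))
  X∣F : X d m ∣ F
  X∣F = subst (X d m ∣_) (pell d m) (m∣m*n (X d m))
  Yn≈K : Y d n ≈ K [mod X d m ]
  Yn≈K = ≈-∣ X∣F (≈-trans (≈-sym (≡+*⇒≈ (trans (proj₂ (Y-cong d (F * w) n))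
           (cong (λ z → Y d n + z) (*-assoc F w _))))) t≈K)

Y-characterisation : ∀ {d κ K E b t c} → 2 ≤ d → 0 < K → 0 < E → K * K ∣ E →
  b ≡ d + (Δ d * (E * E) + 1) * κ → K + K ∣ b →
  t ≈ K [mod Δ d * (E * E) + 1 ] → t ≈ c [mod K + K ] → 0 < c → c ≤ K →
  Square (Δ d * (K * K) + 1) → Square (Δ d * (E * E) + 1) → Square (Δ b * (t * t) + 1) → K ≡ Y d c
Y-characterisation {d} {κ} {K} {E} {b} {t} {c} 2≤d 0<K 0<E K²∣E b≡ 2K∣b t≈K t≈c 0<c c≤K K□ E□ t□
  with square⇒Y d K K□ | square⇒Y d E E□ | square⇒Y b t t□
... | p , refl | m , refl | n , refl with b≡
...   | refl = cong (Y d) (sym (Y-index-determined d κ p m n c 2≤d (0<Y⇒0<n d p 0<K) (0<Y⇒0<n d m 0<E)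
                 K²∣E 2K∣b t≈K t≈c 0<c c≤K))

-- Squares and coprime factors

-- The root of `a` is `gcd a r`, where `r` is the root of the product.
coprime-squareˡ : ∀ {a b} → Coprime a b → Square (a * b) → Square a
coprime-squareˡ {a} {b} cop (r , e) = g , (begin
  g * g                              ≡⟨ c*gcd[m,n]≡gcd[cm,cn] g a r ⟩
  gcd (g * a) (g * r)                ≡⟨ cong₂ gcd (*-comm g a) gr ⟩
  gcd (a * g) (a * gcd r b)          ≡⟨ c*gcd[m,n]≡gcd[cm,cn] a g (gcd r b) ⟨
  a * gcd g (gcd r b)                ≡⟨ cong (a *_) (coprime⇒gcd≡1 cop′) ⟩
  a * 1                              ≡⟨ *-identityʳ a ⟩
  a                                  ∎)
  where
  open ≡-Reasoning
  g = gcd a r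
  gr : g * r ≡ a * gcd r b
  gr = begin
    g * r                  ≡⟨ *-comm g r ⟩
    r * gcd a r            ≡⟨ c*gcd[m,n]≡gcd[cm,cn] r a r ⟩
    gcd (r * a) (r * r)    ≡⟨ cong₂ gcd (*-comm r a) e ⟩
    gcd (a * r) (a * b)    ≡⟨ c*gcd[m,n]≡gcd[cm,cn] a r b ⟨
    a * gcd r b            ∎
  cop′ : Coprime g (gcd r b)
  cop′ (d∣g , d∣h) = cop (∣-trans d∣g (gcd[m,n]∣m a r) , ∣-trans d∣h (gcd[m,n]∣n r b))

coprime-squareʳ : ∀ {a b} → Coprime a b → Square (a * b) → Square b
coprime-squareʳ {a} {b} cop sq =
  coprime-squareˡ {b} {a} (λ (d∣b , d∣a) → cop (d∣a , d∣b)) (subst Square (*-comm a b) sq)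

square-* : ∀ {a b} → Square a → Square b → Square (a * b)
square-* (r , refl) (s , refl) = r * s , interchange r s
  where
  interchange : ∀ r s → r * s * (r * s) ≡ r * r * (s * s)
  interchange = solve-∀

-- A rational square root of a natural number is integral: in lowest terms the denominator `r′`
-- divides `z′`, so it is `1`.
square-*-cancel : ∀ {r a} → 0 < r → Square (r * r * a) → Square a
square-*-cancel {r@(suc _)} {a} 0<r (z , e) = z′ , sym (trans (sym (*-identityˡ a)) (trans (cong (λ w → w * w * a) (sym r′≡1)) r′²a≡z′²))
  where
  g = gcd r z
  instance
    g≢0 : NonZero g
    g≢0 = ≢-nonZero λ g≡0 → contradiction (subst (_∣ r) g≡0 (gcd[m,n]∣m r z)) λ 0∣r → contradiction (0∣⇒≡0 0∣r) λ ()
  r′ = r / g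
  z′ = z / g
  r≡ : r′ * g ≡ r
  r≡ = m/n*n≡m (gcd[m,n]∣m r z)
  z≡ : z′ * g ≡ z
  z≡ = m/n*n≡m (gcd[m,n]∣n r z)
  r′²a≡z′² : r′ * r′ * a ≡ z′ * z′
  r′²a≡z′² = *-cancelʳ-≡ _ _ (g * g) {{m*n≢0 g g}} (begin
    r′ * r′ * a * (g * g)        ≡⟨ split r′ a g ⟩
    (r′ * g) * (r′ * g) * a      ≡⟨ cong (λ w → w * w * a) r≡ ⟩
    r * r * a                    ≡⟨ e ⟨
    z * z                        ≡⟨ cong (λ w → w * w) z≡ ⟨
    z′ * g * (z′ * g)            ≡⟨ split′ z′ g ⟩
    z′ * z′ * (g * g)            ∎)
    where
    open ≡-Reasoning
    split : ∀ r a g → r * r * a * (g * g) ≡ (r * g) * (r * g) * a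
    split = solve-∀
    split′ : ∀ z g → z * g * (z * g) ≡ z * z * (g * g)
    split′ = solve-∀
  cop : Coprime r′ z′
  cop = coprime-/gcd r z
  r′∣z′ : r′ ∣ z′
  r′∣z′ = coprime-divisor cop (subst (r′ ∣_) r′²a≡z′² (∣m⇒∣m*n a (m∣m*n r′)))
  r′≡1 : r′ ≡ 1
  r′≡1 = cop (∣-refl , r′∣z′)

-- The binomial coefficient as a digit

C≤2^ : ∀ n s → n C s ≤ 2 ^ n
C≤2^ n zero = m^n>0 2 n
C≤2^ zero (suc s) = z≤n
C≤2^ (suc n) (suc s) = begin
  suc n C suc s        ≡⟨ nCk+nC[k+1]≡[n+1]C[k+1] n s ⟨
  n C s + n C suc s    ≤⟨ +-mono-≤ (C≤2^ n s) (C≤2^ n (suc s)) ⟩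
  2 ^ n + 2 ^ n        ≡⟨ cong (λ z → 2 ^ n + z) (+-identityʳ (2 ^ n)) ⟨
  2 ^ suc n            ∎
  where open ≤-Reasoning

0<C : ∀ n s → s ≤ n → 0 < n C s
0<C n zero _ = ≤-refl
0<C (suc n) (suc s) (s≤s s≤n) =
  subst (0 <_) (nCk+nC[k+1]≡[n+1]C[k+1] n s) (<-≤-trans (0<C n s s≤n) (m≤m+n (n C s) (n C suc s)))

-- Induction along Pascal's rule; `q` collects the higher digits and `f` the part below weight
-- `u ^ s`. The bound on `f` is multiplied by `u` to avoid the exponent `s - 1`. Positivity of `f`
-- later makes `(1 + u) ^ n / u ^ s` a non-integer.
binomial-digit : ∀ u n s → 0 < u → ∃₂ λ q f →
  (1 + u) ^ n ≡ (q * u + n C s) * u ^ s + f × f * u ≤ 2 ^ n * u ^ s × (0 < s → 0 < f)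
binomial-digit u zero zero 0<u = 0 , 0 , refl , z≤n , λ ()
binomial-digit u zero (suc s) 0<u = 0 , 1 , refl ,
  ≤-trans (≤-reflexive (+-identityʳ u)) (≤-trans (m≤m*n u (u ^ s) {{m^n≢0 u s {{>-nonZero 0<u}}}}) (≤-reflexive (sym (+-identityʳ _)))) , λ _ → z<s
binomial-digit u (suc n) zero 0<u with binomial-digit u n zero 0<u
... | q , f , e , fu≤ , _ = q + q * u + 1 + f , f , trans (cong ((1 + u) *_) e) (expand u q f) ,
  ≤-trans fu≤ (*-monoˡ-≤ 1 (m≤m+n (2 ^ n) _)) , λ ()
  where
  expand : ∀ u q f → (1 + u) * ((q * u + 1) * 1 + f) ≡ ((q + q * u + 1 + f) * u + 1) * 1 + f
  expand = solve-∀
binomial-digit u (suc n) (suc s) 0<u with binomial-digit u n (suc s) 0<u | binomial-digit u n s 0<u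
... | q₁ , f₁ , e₁ , b₁ , p₁ | q₂ , f₂ , e₂ , b₂ , _ =
  q₁ + q₂ , f₁ + u * f₂ , eq , bound , λ 0<s → <-≤-trans (p₁ 0<s) (m≤m+n f₁ (u * f₂))
  where
  c₁ = n C suc s
  c₂ = n C s
  p = u ^ s
  eq : (1 + u) * (1 + u) ^ n ≡ ((q₁ + q₂) * u + suc n C suc s) * u ^ suc s + (f₁ + u * f₂)
  eq = begin
    (1 + u) * (1 + u) ^ n    ≡⟨⟩
    (1 + u) ^ n + u * (1 + u) ^ n                                        ≡⟨ cong₂ (λ a b → a + u * b) e₁ e₂ ⟩
    ((q₁ * u + c₁) * (u * p) + f₁) + u * ((q₂ * u + c₂) * p + f₂)        ≡⟨ collect u q₁ q₂ c₁ c₂ p f₁ f₂ ⟩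
    ((q₁ + q₂) * u + (c₂ + c₁)) * (u * p) + (f₁ + u * f₂)                ≡⟨ cong (λ c → ((q₁ + q₂) * u + c) * (u * p) + (f₁ + u * f₂)) (nCk+nC[k+1]≡[n+1]C[k+1] n s) ⟩
    ((q₁ + q₂) * u + suc n C suc s) * u ^ suc s + (f₁ + u * f₂)          ∎
    where
    open ≡-Reasoning
    collect : ∀ u q₁ q₂ c₁ c₂ p f₁ f₂ → ((q₁ * u + c₁) * (u * p) + f₁) + u * ((q₂ * u + c₂) * p + f₂)
            ≡ ((q₁ + q₂) * u + (c₂ + c₁)) * (u * p) + (f₁ + u * f₂)
    collect = solve-∀
  bound : (f₁ + u * f₂) * u ≤ 2 ^ suc n * u ^ suc s
  bound = begin
    (f₁ + u * f₂) * u                            ≡⟨ split f₁ f₂ u ⟩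
    f₁ * u + u * (f₂ * u)                        ≤⟨ +-mono-≤ b₁ (*-monoʳ-≤ u b₂) ⟩
    2 ^ n * (u * p) + u * (2 ^ n * p)            ≡⟨ merge (2 ^ n) u p ⟩
    2 ^ suc n * u ^ suc s                        ∎
    where
    open ≤-Reasoning
    split : ∀ a b u → (a + u * b) * u ≡ a * u + u * (b * u)
    split = solve-∀
    merge : ∀ a u p → a * (u * p) + u * (a * p) ≡ 2 * a * (u * p)
    merge = solve-∀

-- Estimates for the quotient of Pell numbers

-- This is `(1 + 1/R)^n ≤ 1 + (2^n - 1)/R` without denominators. The summand `R ^ n` on the left
-- carries the `-1`, with which the induction closes by `R + 2^n ≤ R 2^n + 1`.
suc-^-upper : ∀ R n → 0 < R → R * (1 + R) ^ n + R ^ n ≤ R ^ n * (R + 2 ^ n)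
suc-^-upper R zero 0<R = ≤-reflexive (base R)
  where
  base : ∀ R → R * 1 + 1 ≡ 1 * (R + 1)
  base = solve-∀
suc-^-upper R@(suc R₀) (suc n) 0<R = +-cancelʳ-≤ p _ _ (begin
  R * ((1 + R) * p′) + R * p + p       ≡⟨ expand R p p′ ⟩
  (1 + R) * (R * p′ + p)               ≤⟨ *-monoʳ-≤ (1 + R) (suc-^-upper R n 0<R) ⟩
  (1 + R) * (p * (R + a))              ≡⟨ regroup R p a ⟩
  p * (R * R + R * a + (R + a))        ≤⟨ *-monoʳ-≤ p (+-monoʳ-≤ (R * R + R * a) (sum≤product R a 0<R (m^n>0 2 n))) ⟩
  p * (R * R + R * a + (R * a + 1))    ≡⟨ collect R p a ⟩
  R * p * (R + 2 * a) + p              ∎)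
  where
  open ≤-Reasoning
  p = R ^ n
  p′ = (1 + R) ^ n
  a = 2 ^ n
  expand : ∀ R p p′ → R * ((1 + R) * p′) + R * p + p ≡ (1 + R) * (R * p′ + p)
  expand = solve-∀
  regroup : ∀ R p a → (1 + R) * (p * (R + a)) ≡ p * (R * R + R * a + (R + a))
  regroup = solve-∀
  collect : ∀ R p a → p * (R * R + R * a + (R * a + 1)) ≡ R * p * (R + 2 * a) + p
  collect = solve-∀
  sum≤product : ∀ a b → 0 < a → 0 < b → a + b ≤ a * b + 1
  sum≤product (suc a) (suc b) _ _ = ≤-trans (m≤m+n _ (a * b)) (≤-reflexive (identity a b))
    where
    identity : ∀ a b → (1 + a) + (1 + b) + a * b ≡ (1 + a) * (1 + b) + 1
    identity = solve-∀

-- The required size of `R`: the error factor `(1 + 1/R)^n` must not lift the integer `m` to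
-- `1 + m`.
suc-^-gap : ∀ R n m → 2 ^ n * m < R → (1 + R) ^ n * m < R ^ n * (1 + m)
suc-^-gap R n m am<R = *-cancelˡ-< R _ _ (begin-strict
  R * (p′ * m)             ≡⟨ *-assoc R p′ m ⟨
  R * p′ * m               ≤⟨ *-monoˡ-≤ m (≤-trans (m≤m+n _ p) (suc-^-upper R n 0<R)) ⟩
  p * (R + a) * m          ≡⟨ expand p R a m ⟩
  p * (R * m + a * m)      <⟨ *-monoʳ-< p {{m^n≢0 R n}} (+-monoʳ-< (R * m) am<R) ⟩
  p * (R * m + R)          ≡⟨ collect p R m ⟩
  R * (p * (1 + m))        ∎)
  where
  open ≤-Reasoning
  0<R = ≤-<-trans z≤n am<R
  instance _ = >-nonZero 0<R
  p = R ^ n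
  p′ = (1 + R) ^ n
  a = 2 ^ n
  expand : ∀ p R a m → p * (R + a) * m ≡ p * (R * m + a * m)
  expand = solve-∀
  collect : ∀ p R m → p * (R * m + R) ≡ R * (p * (1 + m))
  collect = solve-∀

^-distribʳ-* : ∀ a b n → (a * b) ^ n ≡ a ^ n * b ^ n
^-distribʳ-* a b zero    = refl
^-distribʳ-* a b (suc n) = trans (cong (a * b *_) (^-distribʳ-* a b n)) (interchange a b (a ^ n) (b ^ n))
  where
  interchange : ∀ a b p q → a * b * (p * q) ≡ a * p * (b * q)
  interchange = solve-∀

-- Together with `Y-scaled-upper`, the Pell number is `(2 R)^n c^n` up to a factor `(1 + 1/R)^n`. In
-- the quotient the powers of `2 R` cancel and those of `c` remain.
Y-scaled-lower : ∀ R c n → 2 ^ n * (R ^ n * c ^ n) ≤ Y (R * c) (suc n)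
Y-scaled-lower R c n = begin
  2 ^ n * (R ^ n * c ^ n)    ≡⟨ cong (2 ^ n *_) (^-distribʳ-* R c n) ⟨
  2 ^ n * (R * c) ^ n        ≡⟨ ^-distribʳ-* 2 (R * c) n ⟨
  (2 * (R * c)) ^ n          ≤⟨ ^-monoˡ-≤ n (n≤1+n (2 * (R * c))) ⟩
  (1 + 2 * (R * c)) ^ n      ≤⟨ Y-lower (R * c) n ⟩
  Y (R * c) (suc n)          ∎
  where open ≤-Reasoning

Y-scaled-upper : ∀ R c n → 0 < c → Y (R * c) (suc n) ≤ 2 ^ n * ((1 + R) ^ n * c ^ n)
Y-scaled-upper R c n 0<c = begin
  Y (R * c) (suc n)               ≤⟨ Y-upper (R * c) n ⟩
  (2 * (1 + R * c)) ^ n           ≤⟨ ^-monoˡ-≤ n (*-monoʳ-≤ 2 (+-monoˡ-≤ (R * c) 0<c)) ⟩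
  (2 * ((1 + R) * c)) ^ n         ≡⟨ ^-distribʳ-* 2 ((1 + R) * c) n ⟩
  2 ^ n * ((1 + R) * c) ^ n       ≡⟨ cong (2 ^ n *_) (^-distribʳ-* (1 + R) c n) ⟩
  2 ^ n * ((1 + R) ^ n * c ^ n)   ∎
  where open ≤-Reasoning

-- K / (L P) approximates (1 + u)ⁿ / uˢ closely enough to have the same integer part,
-- whose last digit in base u is the binomial coefficient.
pell-quotient : ∀ R u c s → 0 < s → 2 ^ (c + s) < u → 2 ^ (c + s) * (1 + u) ^ (c + s) < R →
  let K  = Y (R * (1 + u)) (suc (c + s))
      LP = Y (R * 1) (suc c) * Y (R * u) (suc s)
  in ∃ λ q → (q * u + (c + s) C s) * LP < K × K < suc (q * u + (c + s) C s) * LP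
pell-quotient R u c s 0<s 2ⁿ<u aN<R with binomial-digit u (c + s) s (≤-<-trans z≤n 2ⁿ<u)
... | q , f , N≡ , fu≤ , 0<f = q , lower , upper
  where
  open ≤-Reasoning
  n = c + s
  a = 2 ^ n
  N = (1 + u) ^ n
  U = u ^ s
  Q = q * u + n C s
  K = Y (R * (1 + u)) (suc n)
  LP = Y (R * 1) (suc c) * Y (R * u) (suc s)
  p = R ^ n
  p′ = (1 + R) ^ n
  0<u : 0 < u
  0<u = ≤-<-trans z≤n 2ⁿ<u
  instance
    _ = >-nonZero 0<u
    a≢0 : NonZero a
    a≢0 = m^n≢0 2 n
    U≢0 : NonZero U
    U≢0 = m^n≢0 u s
  f<U : f < U
  f<U = *-cancelʳ-< u f U (begin-strict
    f * u    ≤⟨ fu≤ ⟩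
    a * U    <⟨ *-monoˡ-< U 2ⁿ<u ⟩
    u * U    ≡⟨ *-comm u U ⟩
    U * u    ∎)
  collect : ∀ a₁ a₂ p₁ p₂ o U → a₁ * (p₁ * o) * (a₂ * (p₂ * U)) ≡ (a₁ * a₂) * ((p₁ * p₂) * U) * o
  collect = solve-∀
  -- As `c + s = n`, the product `L P` carries the same power of `2 x` as `K`. Writing the parameter
  -- of `L` as `R * 1` lets the same estimate serve it, with the trivial factor `1 ^ c`.
  gather : ∀ x → 2 ^ c * (x ^ c * 1 ^ c) * (2 ^ s * (x ^ s * U)) ≡ a * (x ^ n * U)
  gather x = begin-equality
    2 ^ c * (x ^ c * 1 ^ c) * (2 ^ s * (x ^ s * U))    ≡⟨ collect (2 ^ c) (2 ^ s) (x ^ c) (x ^ s) (1 ^ c) U ⟩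
    (2 ^ c * 2 ^ s) * ((x ^ c * x ^ s) * U) * 1 ^ c    ≡⟨ cong ((2 ^ c * 2 ^ s) * ((x ^ c * x ^ s) * U) *_) (^-zeroˡ c) ⟩
    (2 ^ c * 2 ^ s) * ((x ^ c * x ^ s) * U) * 1        ≡⟨ *-identityʳ _ ⟩
    (2 ^ c * 2 ^ s) * ((x ^ c * x ^ s) * U)            ≡⟨ cong₂ (λ v w → v * (w * U)) (^-distribˡ-+-* 2 c s) (^-distribˡ-+-* x c s) ⟨
    a * (x ^ n * U)                                    ∎
  LP≥ : a * (p * U) ≤ LP
  LP≥ = ≤-trans (≤-reflexive (sym (gather R))) (*-mono-≤ (Y-scaled-lower R 1 c) (Y-scaled-lower R u s))
  LP≤ : LP ≤ a * (p′ * U)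
  LP≤ = ≤-trans (*-mono-≤ (Y-scaled-upper R 1 c z<s) (Y-scaled-upper R u s 0<u)) (≤-reflexive (gather (1 + R)))
  -- `N / U` exceeds `Q` strictly because `f` is positive; this is the room that the error factor
  -- needs from below.
  QU<N : 1 + Q * U ≤ N
  QU<N = begin
    1 + Q * U    ≤⟨ +-monoˡ-≤ (Q * U) (0<f 0<s) ⟩
    f + Q * U    ≡⟨ +-comm f (Q * U) ⟩
    Q * U + f    ≡⟨ N≡ ⟨
    N            ∎
  rotate : ∀ q a p U → q * (a * (p * U)) ≡ a * (p * (q * U))
  rotate = solve-∀
  lower : Q * LP < K
  lower = begin-strict
    Q * LP                 ≤⟨ *-monoʳ-≤ Q LP≤ ⟩
    Q * (a * (p′ * U))     ≡⟨ rotate Q a p′ U ⟩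
    a * (p′ * (Q * U))     <⟨ *-monoʳ-< a (suc-^-gap R n (Q * U) (≤-<-trans (*-monoʳ-≤ a (≤-trans (n≤1+n _) QU<N)) aN<R)) ⟩
    a * (p * (1 + Q * U))  ≤⟨ *-monoʳ-≤ a (*-monoʳ-≤ p QU<N) ⟩
    a * (p * N)            ≤⟨ Y-scaled-lower R (1 + u) n ⟩
    K                      ∎
  upper : K < suc Q * LP
  upper = begin-strict
    K                        ≤⟨ Y-scaled-upper R (1 + u) n z<s ⟩
    a * (p′ * N)             <⟨ *-monoʳ-< a (suc-^-gap R n N aN<R) ⟩
    a * (p * (1 + N))        ≤⟨ *-monoʳ-≤ a (*-monoʳ-≤ p N<) ⟩
    a * (p * (suc Q * U))    ≡⟨ rotate (suc Q) a p U ⟨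
    suc Q * (a * (p * U))    ≤⟨ *-monoʳ-≤ (suc Q) LP≥ ⟩
    suc Q * LP               ∎
    where
    N< : 1 + N ≤ suc Q * U
    N< = begin
      1 + N              ≡⟨ cong suc N≡ ⟩
      1 + (Q * U + f)    ≡⟨ +-suc (Q * U) f ⟨
      Q * U + suc f      ≤⟨ +-monoʳ-≤ (Q * U) f<U ⟩
      Q * U + U          ≡⟨ +-comm (Q * U) U ⟩
      suc Q * U          ∎

-- The congruence Y ≡ index (mod g) makes the index of a solution with Y = g M at least g.
pell-growth : ∀ g M → 0 < g → 0 < M → Square (Δ g * ((g * M) * (g * M)) + 1) → (1 + 2 * g) ^ (pred g) ≤ g * M
pell-growth g@(suc g′) M _ 0<M sq with square⇒Y g (g * M) sq
... | j , gM≡ with Y≡n+d* g j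
...   | k , Y≡ = begin
  (1 + 2 * g) ^ g′   ≤⟨ Y-lower g g′ ⟩
  Y g g              ≤⟨ Y-mono-≤ g (∣⇒≤ {{>-nonZero 0<j}} g∣j) ⟩
  Y g j              ≡⟨ gM≡ ⟨
  g * M              ∎
  where
  open ≤-Reasoning
  0<j : 0 < j
  0<j = 0<Y⇒0<n g j (subst (0 <_) gM≡ (*-mono-≤ {1} {g} z<s 0<M))
  g∣j : g ∣ j
  g∣j = ∣m+n∣m⇒∣n (subst (g ∣_) (trans gM≡ (trans Y≡ (+-comm j (g * k)))) (m∣m*n M)) (m∣m*n k)

-- The equations over abstract operations

-- The equations are written once over abstract operations and instantiated at ℕ and at polynomials.
record Ops (A : Set) : Set where
  infixl 6 _∔_
  infixl 7 _·_
  field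
    lit : ℕ → A
    _∔_ : A → A → A
    _·_ : A → A → A

  δ : A → A
  δ a = a · (lit 2 ∔ a)

-- Matiyasevich's criterion: if D, F and I are squares then K = Y d (n + 1).  Here b ≡ d (mod F) and
-- 2K ∣ b, while t ≡ K (mod F) and t ≡ n + 1 (mod 2K).  The multiples S and D in B make S, D, F, I
-- pairwise coprime.
module Tower {A : Set} (ops : Ops A) (n d K S i j : A) where
  open Ops ops

  D B E V F b t I Z : A
  D = δ d · (K · K) ∔ lit 1
  B = (K ∔ K) · (S · D)
  E = B · K · (lit 1 ∔ i)
  V = δ d · (E · E)
  F = V ∔ lit 1
  b = d · (V · V)
  t = K ∔ F · (lit 1 ∔ n ∔ K ∔ (K ∔ K) · j)
  I = δ b · (t · t) ∔ lit 1
  Z = S · D · (F · I)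

-- The index c stands for n ∸ s.  L ≡ 1 + c (mod R) and P ≡ 1 + s (mod R u) force L = Y R (1 + c) and
-- P = Y (R u) (1 + s) once they are small Pell numbers.
module Ratio {A : Set} (ops : Ops A) (y c s u R l m v : A) where
  open Ops ops

  L P D₂ D₃ LP q : A
  L  = lit 1 ∔ c ∔ R · l
  P  = lit 1 ∔ s ∔ R · u · m
  D₂ = δ R · (L · L) ∔ lit 1
  D₃ = δ (R · u) · (P · P) ∔ lit 1
  LP = L · P
  q  = v · u ∔ y

-- If S is a square then G, and with it R = (1 + w) S, is exponentially large.  The modulus e is
-- chosen such that 2 + e = R (1 + u); it is a polynomial without subtraction.
module Base {A : Set} (ops : Ops A) (y n x w : A) where
  open Ops ops

  u₀ u g G T S R₀ R e : A
  u₀ = y ∔ n ∔ x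
  u  = lit 1 ∔ u₀
  g  = lit 2 ∔ (u ∔ n)
  G  = g · (lit 1 ∔ w)
  T  = δ g · (G · G)
  S  = T ∔ lit 1
  R₀ = w ∔ T ∔ w · T
  R  = lit 1 ∔ R₀
  e  = u₀ ∔ R₀ · (lit 1 ∔ u)

ℕ-ops : Ops ℕ
ℕ-ops = record { lit = λ a → a ; _∔_ = _+_ ; _·_ = _*_ }

-- Soundness: the quotient determines the binomial coefficient

0<Δ : ∀ {d} → 0 < d → 0 < Δ d
0<Δ {suc d} _ = z<s

quotient-≈ : ∀ {m a b} → 0 < m → b ≤ a → a ≈ b [mod m ] → ∃ λ k → a ≡ b + m * k
quotient-≈ {m} {a} {b} 0<m b≤a (witness {k} {l} eq) = conclude (∣m+n∣m⇒∣n (subst (m ∣_) eq′ (m∣m*n l)) (m∣m*n k))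
  where
  a≡ : b + (a ∸ b) ≡ a
  a≡ = m+[n∸m]≡n b≤a
  eq′ : m * l ≡ m * k + (a ∸ b)
  eq′ = +-cancelˡ-≡ b _ _ (trans (sym eq) (trans (cong (_+ m * k) (sym a≡)) (trans (+-assoc b (a ∸ b) (m * k)) (cong (λ z → b + z) (+-comm (a ∸ b) (m * k))))))
  conclude : m ∣ a ∸ b → ∃ λ k → a ≡ b + m * k
  conclude (divides κ κ≡) = κ , trans (sym a≡) (cong (λ z → b + z) (trans κ≡ (*-comm κ m)))

quotient-unique : ∀ {N r} q₁ q₂ → q₁ * r < N → N < suc q₁ * r → q₂ * r < N → N < suc q₂ * r → q₁ ≡ q₂
quotient-unique {N} {r} q₁ q₂ l₁ u₁ l₂ u₂ =
  ≤-antisym (s≤s⁻¹ (*-cancelʳ-< r q₁ (suc q₂) (<-trans l₁ u₂))) (s≤s⁻¹ (*-cancelʳ-< r q₂ (suc q₁) (<-trans l₂ u₁)))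

digit-unique : ∀ {p a b} q₁ q₂ → a < p → b < p → q₁ * p + a ≡ q₂ * p + b → a ≡ b
digit-unique {p} {a} {b} q₁ q₂ a<p b<p eq = ≈-<-≡ (witness {left = q₁} {q₂} (trans (flip a q₁) (trans eq (sym (flip b q₂))))) a<p b<p
  where
  flip : ∀ a q → a + p * q ≡ q * p + a
  flip a q = trans (+-comm a (p * q)) (cong (_+ a) (*-comm p q))

module Sizes (n u R e : ℕ) (0<n : 0 < n) (n<u : n < u) (R≤e : R ≤ e)
  (d-product : 2 + e ≡ R * (1 + u)) (R-large : 2 ^ n * (1 + u) ^ n < R) where

  d : ℕ
  d = 2 + e

  open ≤-Reasoning

  0<R : 0 < R
  0<R = ≤-<-trans z≤n R-large

  2[1+u]<R : 2 * (1 + u) < R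
  2[1+u]<R = ≤-<-trans (begin
    2 * (1 + u)            ≡⟨ ^-identityʳ (2 * (1 + u)) ⟨
    (2 * (1 + u)) ^ 1      ≤⟨ ^-monoʳ-≤ (2 * (1 + u)) 0<n ⟩
    (2 * (1 + u)) ^ n      ≡⟨ ^-distribʳ-* 2 (1 + u) n ⟩
    2 ^ n * (1 + u) ^ n    ∎) R-large

  2n<R : 2 * n < R
  2n<R = ≤-<-trans (*-monoʳ-≤ 2 (≤-trans (<⇒≤ n<u) (n≤1+n u))) 2[1+u]<R

  u<e : u < e
  u<e = <-≤-trans (<-≤-trans (n<1+n u) (≤-trans (m≤n*m (1 + u) 2) (<⇒≤ 2[1+u]<R))) R≤e

  Y₂<e : Y 2 (1 + n) < e
  Y₂<e = begin-strict
    Y 2 (1 + n)            ≤⟨ Y-upper 2 n ⟩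
    6 ^ n                  ≤⟨ ^-monoˡ-≤ n (*-monoʳ-≤ 2 (s≤s (≤-trans (s≤s 0<n) n<u))) ⟩
    (2 * (1 + u)) ^ n      ≡⟨ ^-distribʳ-* 2 (1 + u) n ⟩
    2 ^ n * (1 + u) ^ n    <⟨ R-large ⟩
    R                      ≤⟨ R≤e ⟩
    e                      ∎

  -- Since `d` is about `R (1 + u)` and `1 + u < R ≤ r`, one has `2 (1 + d) < (1 + 2 r)^2`.
  -- Comparing growth rates, `p` is at most `2 n`, which is below `R`.
  Y-index-bound : ∀ r p → R ≤ r → Y r p ≤ Y d (1 + n) → p < R
  Y-index-bound r zero R≤r _ = 0<R
  Y-index-bound r (suc p) R≤r Yp≤ = ≤-<-trans (^-cancelʳ-< p<) 2n<R
    where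
    ^-cancelʳ-< : (1 + 2 * r) ^ p < (1 + 2 * r) ^ (2 * n) → p < 2 * n
    ^-cancelʳ-< lt = ≰⇒> λ 2n≤p → <⇒≱ lt (^-monoʳ-≤ (1 + 2 * r) 2n≤p)
    base : 2 * (1 + d) < (1 + 2 * r) ^ 2
    base = begin-strict
      2 * (1 + d)                        ≡⟨ cong (λ z → 2 * (1 + z)) d-product ⟩
      2 * (1 + R * (1 + u))              ≤⟨ *-monoʳ-≤ 2 (s≤s (*-mono-≤ R≤r (≤-trans (≤-trans (m≤n*m (1 + u) 2) (<⇒≤ 2[1+u]<R)) R≤r))) ⟩
      2 * (1 + r * r)                    <⟨ m<m+n _ (≤-trans 0<R (≤-trans R≤r (m≤m+n r (r + 2 * (r * r))))) ⟩
      2 * (1 + r * r) + (r + (r + 2 * (r * r)))     ≡⟨ split r ⟩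
      1 + (1 + 2 * r + 4 * (r * r))                 ≤⟨ +-monoˡ-≤ (1 + 2 * r + 4 * (r * r)) (≤-trans (≤-trans 0<R R≤r) (m≤n*m r 2)) ⟩
      2 * r + (1 + 2 * r + 4 * (r * r))             ≡⟨ merge r ⟩
      (1 + 2 * r) ^ 2                    ∎
      where
      split : ∀ r → 2 * (1 + r * r) + (r + (r + 2 * (r * r))) ≡ 1 + (1 + 2 * r + 4 * (r * r))
      split = solve-∀
      merge : ∀ r → 2 * r + (1 + 2 * r + 4 * (r * r)) ≡ (1 + 2 * r) * ((1 + 2 * r) * 1)
      merge = solve-∀
    p< : (1 + 2 * r) ^ p < (1 + 2 * r) ^ (2 * n)
    p< = begin-strict
      (1 + 2 * r) ^ p              ≤⟨ Y-lower r p ⟩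
      Y r (1 + p)                  ≤⟨ Yp≤ ⟩
      Y d (1 + n)                  ≤⟨ Y-upper d n ⟩
      (2 * (1 + d)) ^ n            <⟨ ^-monoˡ-< n {{>-nonZero 0<n}} base ⟩
      ((1 + 2 * r) ^ 2) ^ n        ≡⟨ ^-*-assoc (1 + 2 * r) 2 n ⟩
      (1 + 2 * r) ^ (2 * n)        ∎

  -- Modulo `r`, `L` is `1 + a` by its form and `p` by being the `p`-th Pell number; both are below
  -- `R ≤ r`.
  Y-index-unique : ∀ {r a α L} → R ≤ r → 1 + a < R → L ≡ 1 + a + r * α → L ≤ Y d (1 + n) →
    Square (Δ r * (L * L) + 1) → L ≡ Y r (1 + a)
  Y-index-unique {r} {a} {α} {L} R≤r 1+a<R L≡ L≤Y □ = trans Y≡ (cong (Y r) (sym a≡p))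
    where
    p = proj₁ (square⇒Y r L □)
    Y≡ : L ≡ Y r p
    Y≡ = proj₂ (square⇒Y r L □)
    p<R : p < R
    p<R = Y-index-bound r p R≤r (subst (_≤ Y d (1 + n)) Y≡ L≤Y)
    a≡p : 1 + a ≡ p
    a≡p = ≈-<-≡ (≈-trans (≈-sym (≡+*⇒≈ L≡)) (≡+*⇒≈ (trans Y≡ (proj₂ (Y≡n+d* r p)))))
            (<-≤-trans 1+a<R R≤r) (<-≤-trans p<R R≤r)

module RatioSound (y c s u R e k l m v : ℕ) (0<s : 0 < s)
  (n<u : c + s < u) (y<u : y < u) (R≤e : R ≤ e) (d-product : 2 + e ≡ R * (1 + u))
  (R-large : 2 ^ (c + s) * (1 + u) ^ (c + s) < R) (K-index : u + e * k ≡ Y (2 + e) (1 + (c + s)))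
  (D₂□ : Square (Ratio.D₂ ℕ-ops y c s u R l m v)) (D₃□ : Square (Ratio.D₃ ℕ-ops y c s u R l m v)) (0<y : 0 < y)
  (qLP<K : Ratio.q ℕ-ops y c s u R l m v * Ratio.LP ℕ-ops y c s u R l m v < u + e * k)
  (K<qLP : u + e * k < suc (Ratio.q ℕ-ops y c s u R l m v) * Ratio.LP ℕ-ops y c s u R l m v) where

  open Ratio ℕ-ops y c s u R l m v using (L; P; LP; q)

  n K : ℕ
  n = c + s
  K = u + e * k

  0<n : 0 < n
  0<n = <-≤-trans 0<s (m≤n+m s c)

  open Sizes n u R e 0<n n<u R≤e d-product R-large

  -- Modulo `e`, `K` is `u` by its form and `Y 2 (1 + n)` by its index, and both are below `e`.
  u≡Y : u ≡ Y 2 (1 + n)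
  u≡Y with Y-cong 2 e (1 + n)
  ... | κ , eq = ≈-<-≡ (witness {left = k} {κ} (trans K-index eq)) u<e Y₂<e

  2ⁿ<u : 2 ^ n < u
  2ⁿ<u = <-≤-trans (^-monoˡ-< n {{>-nonZero 0<n}} (s≤s (s≤s (s≤s z≤n)))) (≤-trans (Y-lower 2 n) (≤-reflexive (sym u≡Y)))

  C<u : n C s < u
  C<u = ≤-<-trans (C≤2^ n s) 2ⁿ<u

  -- Positivity of `y` makes `q` positive. This is the bound that `Y-index-unique` needs for `L` and
  -- `P`.
  LP≤K : LP ≤ K
  LP≤K = ≤-trans (m≤n*m LP q {{>-nonZero (<-≤-trans 0<y (m≤n+m y (v * u)))}}) (<⇒≤ qLP<K)

  LP≤Y : LP ≤ Y (2 + e) (1 + n)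
  LP≤Y = subst (LP ≤_) K-index LP≤K

  R≤Ru : R ≤ R * u
  R≤Ru = m≤m*n R u {{>-nonZero (≤-<-trans z≤n n<u)}}

  1+n<R : 1 + n < R
  1+n<R = ≤-<-trans (≤-trans n<u (≤-trans (n≤1+n u) (m≤n*m (1 + u) 2))) 2[1+u]<R

  LP≡ : LP ≡ Y (R * 1) (1 + c) * Y (R * u) (1 + s)
  LP≡ = cong₂ _*_
    (trans (Y-index-unique {α = l} ≤-refl (≤-<-trans (s≤s (m≤m+n c s)) 1+n<R) refl (≤-trans (m≤m*n L P {{_}}) LP≤Y) D₂□)
      (cong (λ z → Y z (1 + c)) (sym (*-identityʳ R))))
    (Y-index-unique {α = m} R≤Ru (≤-<-trans (s≤s (m≤n+m s c)) 1+n<R) refl (≤-trans (m≤n*m P L {{_}}) LP≤Y) D₃□)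

  K≡ : K ≡ Y (R * (1 + u)) (1 + n)
  K≡ = trans K-index (cong (λ z → Y z (1 + n)) d-product)

  ratio = pell-quotient R u c s 0<s 2ⁿ<u R-large
  q′ = proj₁ ratio

  y≡C : y ≡ n C s
  y≡C = digit-unique v q′ y<u C<u (quotient-unique q (q′ * u + n C s) qLP<K K<qLP
    (subst₂ _<_ (cong ((q′ * u + n C s) *_) (sym LP≡)) (sym K≡) (proj₁ (proj₂ ratio)))
    (subst₂ _<_ (sym K≡) (cong (suc (q′ * u + n C s) *_) (sym LP≡)) (proj₂ (proj₂ ratio))))

-- Soundness: coprimality of the factors of `Z`

module TowerProperties (n d K S i j : ℕ) (S∣d : S ∣ d) (2≤d : 2 ≤ d) (0<S : 0 < S) (n<K : n < K) where
  open Tower ℕ-ops n d K S i j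

  0<K : 0 < K
  0<K = ≤-<-trans z≤n n<K

  S-coprime-D : Coprime S D
  S-coprime-D = coprime-1+ (∣m⇒∣m*n (K * K) (∣m⇒∣m*n (2 + d) S∣d)) refl

  E∣V : E ∣ V
  E∣V = ∣n⇒∣m*n (Δ d) (m∣m*n E)

  B∣E : B ∣ E
  B∣E = ∣m⇒∣m*n (1 + i) (m∣m*n K)

  B∣V : B ∣ V
  B∣V = ∣-trans B∣E E∣V

  V∣b : V ∣ b
  V∣b = ∣n⇒∣m*n d (m∣m*n V)

  2K∣B : K + K ∣ B
  2K∣B = m∣m*n (S * D)

  0<E : 0 < E
  0<E = *-mono-≤ {1} {B * K} (*-mono-≤ {1} {B} 0<B 0<K) z<s
    where
    0<B : 0 < B
    0<B = *-mono-≤ {1} {K + K} (≤-trans 0<K (m≤m+n K K)) (*-mono-≤ {1} {S} 0<S (m≤n+m 1 (Δ d * (K * K))))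

  0<V : 0 < V
  0<V = *-mono-≤ {1} {Δ d} (0<Δ (<-trans z<s 2≤d)) (*-mono-≤ 0<E 0<E)

  -- `V ≡ -1` modulo `F = V + 1`, so `d V²` is `d` modulo `F`, while every divisor of `V`, in
  -- particular `2K`, divides it. Thus `b` meets both congruences of the criterion without an
  -- unknown of its own. In the witness, `V₀` is `V - 1`.
  b-shift : ∃ λ κ → b ≡ d + F * κ
  b-shift = shift V 0<V
    where
    shift : ∀ V → 0 < V → ∃ λ κ → d * (V * V) ≡ d + (V + 1) * κ
    shift (suc V₀) _ = d * V₀ , expand d V₀
      where
      expand : ∀ d v → d * ((1 + v) * (1 + v)) ≡ d + (1 + v + 1) * (d * v)
      expand = solve-∀

  D∣B : D ∣ B
  D∣B = ∣n⇒∣m*n (K + K) (n∣m*n S)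

  -- As `b ≡ d` and `t ≡ K` modulo `F`, also `I ≡ D`. A common divisor of `F` and `I` therefore
  -- divides `D`, hence `V = F - 1`.
  F-coprime-I : Coprime F I
  F-coprime-I {h} (h∣F , h∣I) = coprime-1+ (∣-trans D∣B B∣V) refl (h∣D , h∣F)
    where
    κ = proj₁ b-shift
    τ = 1 + n + K + (K + K) * j
    expand : ∀ d F κ K τ →
      (d + F * κ) * (2 + (d + F * κ)) * ((K + F * τ) * (K + F * τ)) + 1
      ≡ F * (d * (2 + d) * (K * τ + (K + F * τ) * τ) + κ * (2 + 2 * d + F * κ) * ((K + F * τ) * (K + F * τ)))
        + (d * (2 + d) * (K * K) + 1)
    expand = solve-∀
    h∣D : h ∣ D
    h∣D = ∣m+n∣m⇒∣n (subst (h ∣_) (trans (cong (λ z → Δ z * (t * t) + 1) (proj₂ b-shift)) (expand d F κ K τ)) h∣I)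
            (∣m⇒∣m*n _ h∣F)

  -- Both `F` and `I` are `1` modulo `V`, the latter because `V ∣ b`, and `S D` divides `V`.
  SD-coprime-FI : Coprime (S * D) (F * I)
  SD-coprime-FI = coprime-1+ {m = V * I + Δ b * (t * t)}
      (∣m∣n⇒∣m+n (∣m⇒∣m*n I SD∣V) (∣m⇒∣m*n (t * t) (∣m⇒∣m*n (2 + b) (∣-trans SD∣V V∣b))))
      (expand V (Δ b * (t * t)))
    where
    SD∣V : S * D ∣ V
    SD∣V = ∣-trans (n∣m*n (K + K)) B∣V
    expand : ∀ V r → (V + 1) * (r + 1) ≡ V * (r + 1) + r + 1
    expand = solve-∀

  K²∣E : K * K ∣ E
  K²∣E = ∣m⇒∣m*n (1 + i) (*-monoˡ-∣ K (∣-trans (k∣k+k K) 2K∣B))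
    where
    k∣k+k : ∀ k → k ∣ k + k
    k∣k+k k = ∣m∣n⇒∣m+n ∣-refl ∣-refl

  -- F ≡ 1 (mod 2K), and K + (1 + n + K) = 1 + n + 2K.
  t≈1+n : t ≈ 1 + n [mod K + K ]
  t≈1+n = reduce (∣-trans 2K∣B B∣V)
    where
    reduce : K + K ∣ V → t ≈ 1 + n [mod K + K ]
    reduce (divides ρ V≡) = ≡+*⇒≈ (trans (cong (λ z → K + (z + 1) * (1 + n + K + (K + K) * j)) V≡) (expand n K j ρ))
      where
      expand : ∀ n K j ρ → K + (ρ * (K + K) + 1) * (1 + n + K + (K + K) * j)
             ≡ 1 + n + (K + K) * (1 + j + ρ * (1 + n + K + (K + K) * j))
      expand = solve-∀

  Z-square-sound : Square Z → Square S × K ≡ Y d (1 + n)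
  Z-square-sound Z□ = coprime-squareˡ S-coprime-D SD□ ,
    Y-characterisation {κ = proj₁ b-shift} 2≤d 0<K 0<E K²∣E (proj₂ b-shift)
      (∣-trans 2K∣B (∣-trans B∣V V∣b)) (≡+*⇒≈ refl) t≈1+n z<s n<K
      (coprime-squareʳ S-coprime-D SD□) (coprime-squareˡ F-coprime-I FI□) (coprime-squareʳ F-coprime-I FI□)
    where
    SD□ : Square (S * D)
    SD□ = coprime-squareˡ SD-coprime-FI Z□
    FI□ : Square (F * I)
    FI□ = coprime-squareʳ SD-coprime-FI Z□

-- Size relations among the base parameters

module BaseProperties (y n x w : ℕ) where
  open Base ℕ-ops y n x w

  n<u : n < u
  n<u = s≤s (≤-trans (m≤n+m n y) (m≤m+n (y + n) x))

  y<u : y < u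
  y<u = s≤s (≤-trans (m≤m+n y n) (m≤m+n (y + n) x))

  0<S : 0 < S
  0<S = m≤n+m 1 T

  0<G : 0 < G
  0<G = z<s

  R-product : (1 + w) * S ≡ R
  R-product = expand w T
    where
    expand : ∀ w t → (1 + w) * (t + 1) ≡ 1 + (w + t + w * t)
    expand = solve-∀

  d-product : 2 + e ≡ R * (1 + u)
  d-product = expand R₀ u₀
    where
    expand : ∀ r u → 2 + (u + r * (1 + (1 + u))) ≡ (1 + r) * (1 + (1 + u))
    expand = solve-∀

  open ≤-Reasoning

  G≤R : G ≤ R
  G≤R = begin
    G                    ≤⟨ m≤m*n G G {{>-nonZero 0<G}} ⟩
    G * G                ≤⟨ m≤n*m (G * G) (Δ g) {{>-nonZero (0<Δ {g} z<s)}} ⟩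
    T                    ≤⟨ m≤m+n T 1 ⟩
    S                    ≤⟨ m≤n*m S (1 + w) ⟩
    (1 + w) * S          ≡⟨ R-product ⟩
    R                    ∎

  S∣d : S ∣ 2 + e
  S∣d = subst (S ∣_) (sym d-product) (∣m⇒∣m*n (1 + u) (subst (S ∣_) R-product (n∣m*n (1 + w))))

  R≤e : R ≤ e
  R≤e = begin
    1 + R₀                  ≤⟨ +-monoˡ-≤ R₀ 0<R₀ ⟩
    R₀ + R₀                 ≡⟨ double R₀ ⟩
    R₀ * 2                  ≤⟨ *-monoʳ-≤ R₀ (s≤s (s≤s z≤n)) ⟩
    R₀ * (1 + u)            ≤⟨ m≤n+m _ u₀ ⟩
    e                       ∎
    where
    0<R₀ : 0 < R₀
    0<R₀ = ≤-trans (*-mono-≤ {1} {Δ g} z<s (*-mono-≤ {1} {G} z<s z<s)) (≤-trans (m≤n+m T w) (m≤m+n (w + T) (w * T)))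
    double : ∀ r → r + r ≡ r * 2
    double = solve-∀

  -- The value `g = 2 + (u + n)` is large enough in both places: `2 (1 + u)` is below `1 + 2 g`, and
  -- `n` is below `pred g`.
  R-large : (1 + 2 * g) ^ pred g ≤ G → 2 ^ n * (1 + u) ^ n < R
  R-large growth = begin-strict
    2 ^ n * (1 + u) ^ n          ≡⟨ ^-distribʳ-* 2 (1 + u) n ⟨
    (2 * (1 + u)) ^ n            ≤⟨ ^-monoˡ-≤ n 2+2u≤ ⟩
    (1 + 2 * g) ^ n              <⟨ ^-monoʳ-< (1 + 2 * g) (s≤s z<s) (s≤s (m≤n+m n u)) ⟩
    (1 + 2 * g) ^ pred g         ≤⟨ growth ⟩
    G                            ≤⟨ G≤R ⟩
    R                            ∎
    where
    2+2u≤ : 2 * (1 + u) ≤ 1 + 2 * g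
    2+2u≤ = ≤-trans (*-monoʳ-≤ 2 (≤-trans (s≤s (m≤m+n u n)) (n≤1+n _))) (n≤1+n (2 * g))

-- The system of conditions and its soundness

-- Meeting point of both directions, free of integer encodings. `c`, `u`, `R`, `e` and `S` are
-- parameters, so that only their relations to each other enter the arguments.
record Solves (y n c s u R e S k l m i j v : ℕ) : Set where
  open Ratio ℕ-ops y c s u R l m v
  field
    Z□    : Square (Tower.Z ℕ-ops n (2 + e) (u + e * k) S i j)
    D₂□   : Square D₂
    D₃□   : Square D₃
    0<y   : 0 < y
    qLP<K : q * LP < u + e * k
    K<qLP : u + e * k < suc q * LP

-- Largeness of `R` is supplied as a consequence of `Square S`, because that squareness is itself
-- extracted from `Z`.
solves-sound : ∀ {y n c s u R e S k l m i j v} → n ≡ c + s → 0 < s → S ∣ 2 + e → 0 < S → n < u → y < u → R ≤ e →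
  2 + e ≡ R * (1 + u) → (Square S → 2 ^ n * (1 + u) ^ n < R) → Solves y n c s u R e S k l m i j v → y ≡ n C s
solves-sound {y} {_} {c} {s} {u} {R} {e} {S} {k} {l} {m} {i} {j} {v} refl 0<s S∣d 0<S n<u y<u R≤e d-product R-large sol =
  RatioSound.y≡C y c s u R e k l m v 0<s n<u y<u R≤e d-product (R-large (proj₁ S□,K-index)) (proj₂ S□,K-index)
    D₂□ D₃□ 0<y qLP<K K<qLP
  where
  open Solves sol
  S□,K-index : Square S × u + e * k ≡ Y (2 + e) (1 + (c + s))
  S□,K-index = TowerProperties.Z-square-sound (c + s) (2 + e) (u + e * k) S i j S∣d (s≤s (s≤s z≤n)) 0<S (≤-trans n<u (m≤m+n u (e * k))) Z□

-- Completeness: choosing the unknowns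

Y⇒square : ∀ {d y} n → y ≡ Y d n → Square (Δ d * (y * y) + 1)
Y⇒square {d} n refl = X d n , pell d n

Y-multiple-suc : ∀ d B → 0 < B → ∃₂ λ i n → B * (1 + i) ≡ Y d n
Y-multiple-suc d B 0<B with Y-multiple d B 0<B
... | n , 0<n , divides zero    Y≡ = contradiction (sym Y≡) (<⇒≢ (≤-trans 0<n (n≤Y d n)))
... | n , 0<n , divides (suc i) Y≡ = i , n , trans (*-comm B (suc i)) (sym Y≡)

-- From `b ≡ d` modulo `F = V + 1`, `Y b (1 + n) = K + F τ`. Modulo `2K`, `F ≡ 1` and
-- `Y b (1 + n) ≡ 1 + n`, so `τ ≡ 1 + n - K ≡ 1 + n + K`. For a natural `j`, `τ` must also reach
-- `1 + n + K`; it does, since `Y b (1 + n)` is at least `1 + 2 b` with `b = d V²`.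
Y-representable : ∀ {d K V b κ n} → 0 < n → 2 ≤ d → n < K → K + K ≤ V → K + K ∣ V →
  b ≡ d * (V * V) → b ≡ d + (V + 1) * κ → K ≡ Y d (1 + n) →
  ∃ λ j → K + (V + 1) * (1 + n + K + (K + K) * j) ≡ Y b (1 + n)
Y-representable {d} {K} {V} {b} {κ} {n} 0<n 2≤d n<K 2K≤V 2K∣V b≡₁ b≡₂ K≡ =
  proj₁ j,τ≡ , trans (cong (λ z → K + (V + 1) * z) (sym (proj₂ j,τ≡))) (sym Yb≡)
  where
  κ′ = proj₁ (Y-cong d ((V + 1) * κ) (1 + n))
  τ = κ * κ′
  Yb≡ : Y b (1 + n) ≡ K + (V + 1) * τ
  Yb≡ = trans (cong (λ z → Y z (1 + n)) b≡₂) (trans (proj₂ (Y-cong d ((V + 1) * κ) (1 + n)))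
          (cong₂ _+_ (sym K≡) (*-assoc (V + 1) κ κ′)))
  0<K : 0 < K
  0<K = ≤-<-trans z≤n n<K
  2K∣b : K + K ∣ b
  2K∣b = subst (K + K ∣_) (sym b≡₁) (∣n⇒∣m*n d (∣m⇒∣m*n V 2K∣V))
  τ-large : 1 + n + K ≤ τ
  τ-large = ≮⇒≥ λ τ< → <-irrefl refl (begin-strict
    Y b (1 + n)                          ≡⟨ Yb≡ ⟩
    K + (V + 1) * τ                      ≤⟨ +-monoʳ-≤ K (*-monoʳ-≤ (V + 1) (≤-trans (s≤s⁻¹ τ<) (+-monoˡ-≤ K (<⇒≤ n<K)))) ⟩
    K + (V + 1) * (K + K)                ≤⟨ +-mono-≤ (≤-trans (m≤m+n K K) 2K≤V) (*-monoʳ-≤ (V + 1) 2K≤V) ⟩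
    V + (V + 1) * V                      ≡⟨ expand V ⟩
    V * 1 + (V * 1 + V * V)              ≤⟨ +-mono-≤ (*-monoʳ-≤ V 0<V) (+-monoˡ-≤ (V * V) (*-monoʳ-≤ V 0<V)) ⟩
    V * V + (V * V + V * V)              ≤⟨ m≤n+m _ (V * V) ⟩
    V * V + (V * V + (V * V + V * V))    ≡⟨ collect (V * V) ⟩
    2 * (2 * (V * V))                    ≤⟨ *-monoʳ-≤ 2 (*-monoˡ-≤ (V * V) 2≤d) ⟩
    2 * (d * (V * V))                    ≡⟨ cong (2 *_) b≡₁ ⟨
    2 * b                                <⟨ n<1+n _ ⟩
    1 + 2 * b                            ≡⟨ ^-identityʳ (1 + 2 * b) ⟨
    (1 + 2 * b) ^ 1                      ≤⟨ ^-monoʳ-≤ (1 + 2 * b) 0<n ⟩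
    (1 + 2 * b) ^ n                      ≤⟨ Y-lower b n ⟩
    Y b (1 + n)                          ∎)
    where
    open ≤-Reasoning
    0<V : 0 < V
    0<V = ≤-trans 0<K (≤-trans (m≤m+n K K) 2K≤V)
    expand : ∀ V → V + (V + 1) * V ≡ V * 1 + (V * 1 + V * V)
    expand = solve-∀
    collect : ∀ a → a + (a + (a + a)) ≡ 2 * (2 * a)
    collect = solve-∀
  τ≈ : τ ≈ 1 + n + K [mod K + K ]
  τ≈ = reduce 2K∣V 2K∣b
    where
    reduce : K + K ∣ V → K + K ∣ b → τ ≈ 1 + n + K [mod K + K ]
    reduce (divides ρ V≡) (divides σ b≡σ) = witness {left = 1 + ρ * τ} {σ * κ″} (begin
      τ + (K + K) * (1 + ρ * τ)            ≡⟨ expand τ K ρ ⟩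
      K + (ρ * (K + K) + 1) * τ + K        ≡⟨ cong (λ z → K + (z + 1) * τ + K) V≡ ⟨
      K + (V + 1) * τ + K                  ≡⟨ cong (_+ K) Yb≡ ⟨
      Y b (1 + n) + K                      ≡⟨ cong (_+ K) (proj₂ (Y≡n+d* b (1 + n))) ⟩
      1 + n + b * κ″ + K                   ≡⟨ cong (λ z → 1 + n + z * κ″ + K) b≡σ ⟩
      1 + n + σ * (K + K) * κ″ + K         ≡⟨ collect n σ K κ″ ⟩
      1 + n + K + (K + K) * (σ * κ″)       ∎)
      where
      open ≡-Reasoning
      κ″ = proj₁ (Y≡n+d* b (1 + n))
      expand : ∀ τ K ρ → τ + (K + K) * (1 + ρ * τ) ≡ K + (ρ * (K + K) + 1) * τ + K
      expand = solve-∀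
      collect : ∀ n σ K κ → 1 + n + σ * (K + K) * κ + K ≡ 1 + n + K + (K + K) * (σ * κ)
      collect = solve-∀
  j,τ≡ : ∃ λ j → τ ≡ 1 + n + K + (K + K) * j
  j,τ≡ = quotient-≈ (≤-trans 0<K (m≤m+n K K)) τ-large τ≈

tower-complete : ∀ {n d K S} → 0 < n → S ∣ d → 2 ≤ d → 0 < S → n < K → Square S → K ≡ Y d (1 + n) →
  ∃₂ λ i j → Square (Tower.Z ℕ-ops n d K S i j)
tower-complete {n} {d} {K} {S} 0<n S∣d 2≤d 0<S n<K S□ K≡ = i , j , square-* (square-* S□ D□) (square-* F□ I□)
  where
  -- `D` and `B` contain neither `i` nor `j`, so the arguments `0 0` are placeholders and `i` can be
  -- chosen afterwards.
  open Tower ℕ-ops n d K S using (D; B)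
  0<K : 0 < K
  0<K = ≤-<-trans z≤n n<K
  0<D : 0 < D 0 0
  0<D = m≤n+m 1 (Δ d * (K * K))
  0<BK : 0 < B 0 0 * K
  0<BK = *-mono-≤ {1} {B 0 0} (*-mono-≤ {1} {K + K} (≤-trans 0<K (m≤m+n K K)) (*-mono-≤ 0<S 0<D)) 0<K
  -- This makes `E = B K (1 + i)` a Pell number, hence `F` a square.
  multiple = Y-multiple-suc d (B 0 0 * K) 0<BK
  i = proj₁ multiple
  open TowerProperties n d K S i 0 S∣d 2≤d 0<S n<K using (2K∣B; B∣E; E∣V; 0<E; 0<V; b-shift)
  V = Tower.V ℕ-ops n d K S i 0
  2K∣V : K + K ∣ V
  2K∣V = ∣-trans 2K∣B (∣-trans B∣E E∣V)
  representation = Y-representable {κ = proj₁ b-shift} 0<n 2≤d n<K (∣⇒≤ {{>-nonZero 0<V}} 2K∣V) 2K∣V refl (proj₂ b-shift) K≡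
  j = proj₁ representation
  D□ : Square (D i j)
  D□ = Y⇒square (1 + n) K≡
  F□ : Square (Tower.F ℕ-ops n d K S i j)
  F□ = Y⇒square (proj₁ (proj₂ multiple)) (proj₂ (proj₂ multiple))
  I□ : Square (Tower.I ℕ-ops n d K S i j)
  I□ = Y⇒square (1 + n) (proj₂ representation)

ratio-complete : ∀ {y n c s u R K} → n ≡ c + s → y ≡ n C s → 0 < s → 2 ^ n < u → 2 ^ n * (1 + u) ^ n < R →
  K ≡ Y (R * (1 + u)) (1 + n) →
  ∃₂ λ l m → ∃ λ v → let open Ratio ℕ-ops y c s u R l m v in
    Square D₂ × Square D₃ × q * LP < K × K < suc q * LP
ratio-complete {_} {_} {c} {s} {u} {R} {K} refl refl 0<s 2ⁿ<u R-large K≡ =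
  l , m , v , Y⇒square (1 + c) (sym L≡) , Y⇒square (1 + s) (sym P≡) ,
  subst₂ _<_ (cong ((v * u + (c + s) C s) *_) (sym LP≡)) (sym K≡) (proj₁ (proj₂ ratio)) ,
  subst₂ _<_ (sym K≡) (cong (suc (v * u + (c + s) C s) *_) (sym LP≡)) (proj₂ (proj₂ ratio))
  where
  l = proj₁ (Y≡n+d* R (1 + c))
  m = proj₁ (Y≡n+d* (R * u) (1 + s))
  L≡ : Y R (1 + c) ≡ 1 + c + R * l
  L≡ = proj₂ (Y≡n+d* R (1 + c))
  P≡ : Y (R * u) (1 + s) ≡ 1 + s + R * u * m
  P≡ = proj₂ (Y≡n+d* (R * u) (1 + s))
  ratio = pell-quotient R u c s 0<s 2ⁿ<u R-large
  v = proj₁ ratio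
  LP≡ : (1 + c + R * l) * (1 + s + R * u * m) ≡ Y (R * 1) (1 + c) * Y (R * u) (1 + s)
  LP≡ = cong₂ _*_ (trans (sym L≡) (cong (λ z → Y z (1 + c)) (sym (*-identityʳ R)))) (sym P≡)

Y₂-large : ∀ {y n} → 0 < n → y ≤ 2 ^ n → ∃ λ x → 1 + (y + n + x) ≡ Y 2 (1 + n)
Y₂-large {y} {n} 0<n y≤2ⁿ = Y 2 (1 + n) ∸ (1 + (y + n)) , m+[n∸m]≡n (begin
  1 + (y + n)         ≡⟨ +-suc y n ⟨
  y + (1 + n)         ≤⟨ +-mono-≤ y≤2ⁿ (n<2^n n) ⟩
  2 ^ n + 2 ^ n       ≡⟨ cong (λ z → 2 ^ n + z) (+-identityʳ (2 ^ n)) ⟨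
  2 * 2 ^ n           ≡⟨ cong (_* 2 ^ n) (^-identityʳ 2) ⟨
  2 ^ 1 * 2 ^ n       ≤⟨ *-monoˡ-≤ (2 ^ n) (^-monoʳ-≤ 2 0<n) ⟩
  2 ^ n * 2 ^ n       ≡⟨ ^-distribʳ-* 2 2 n ⟨
  4 ^ n               ≤⟨ ^-monoˡ-≤ n (n≤1+n 4) ⟩
  5 ^ n               ≤⟨ Y-lower 2 n ⟩
  Y 2 (1 + n)         ∎)
  where
  open ≤-Reasoning
  n<2^n : ∀ n → n < 2 ^ n
  n<2^n zero    = z<s
  n<2^n (suc n) = +-mono-≤ (m^n>0 2 n) (≤-trans (n<2^n n) (m≤m+n (2 ^ n) 0))

solves-complete : ∀ {y n c s u R e S} → n ≡ c + s → y ≡ n C s → 0 < s → s ≤ n → S ∣ 2 + e → 0 < S → n < u →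
  2 + e ≡ R * (1 + u) → 2 ^ n * (1 + u) ^ n < R → Square S → u ≡ Y 2 (1 + n) →
  ∃ λ k → ∃₂ λ l m → ∃₂ λ i j → ∃ λ v → Solves y n c s u R e S k l m i j v
solves-complete {y} {n} {c} {s} {u} {R} {e} {S} n≡ y≡ 0<s s≤n S∣d 0<S n<u d-product R-large S□ u≡ =
  let k , Y≡ = Y-cong 2 e (1 + n)
      K≡ = trans (cong (_+ e * k) u≡) (sym Y≡)
      i , j , Z□ = tower-complete {K = u + e * k} 0<n S∣d (s≤s (s≤s z≤n)) 0<S (≤-trans n<u (m≤m+n u (e * k))) S□ K≡
      l , m , v , D₂□ , D₃□ , qLP<K , K<qLP =
        ratio-complete n≡ y≡ 0<s 2ⁿ<u R-large (trans K≡ (cong (λ z → Y z (1 + n)) d-product))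
  in k , l , m , i , j , v , record
    { Z□ = Z□ ; D₂□ = D₂□ ; D₃□ = D₃□ ; 0<y = subst (0 <_) (sym y≡) (0<C n s s≤n) ; qLP<K = qLP<K ; K<qLP = K<qLP }
  where
  0<n : 0 < n
  0<n = <-≤-trans 0<s s≤n
  2ⁿ<u : 2 ^ n < u
  2ⁿ<u = <-≤-trans (^-monoˡ-< n {{>-nonZero 0<n}} (s≤s (s≤s (s≤s z≤n)))) (≤-trans (Y-lower 2 n) (≤-reflexive (sym u≡)))

base-complete : ∀ {y n} → 0 < n → y ≤ 2 ^ n →
  ∃₂ λ x w → Base.u ℕ-ops y n x w ≡ Y 2 (1 + n) × Square (Base.S ℕ-ops y n x w)
base-complete {y} {n} 0<n y≤2ⁿ with Y₂-large 0<n y≤2ⁿ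
-- `Y g g ≡ g` modulo `g`, so `Y g g = g + g w`, which is `G`.
... | x , u≡ = x , w , u≡ , Y⇒square g (trans (*-suc g w) (sym (proj₂ (Y≡n+d* g g))))
  where
  g = 2 + (1 + (y + n + x) + n)
  w = proj₁ (Y≡n+d* g g)

-- Merging the conditions into integer equations

infixl 6 _⊖_
-- Polynomials lack subtraction; this is the shape to which `_⊖ᵖ_` evaluates.
_⊖_ : ℤ → ℤ → ℤ
a ⊖ b = a ℤ.+ ℤ.-1ℤ ℤ.* b

⊖≡0⇒≡ : ∀ a b → a ⊖ b ≡ + 0 → a ≡ b
⊖≡0⇒≡ a b eq = trans (expand a b) (trans (cong (ℤ._+ b) eq) (ℤ.+-identityˡ b))
  where
  expand : ∀ a b → a ≡ (a ℤ.+ ℤ.-1ℤ ℤ.* b) ℤ.+ b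
  expand = ℤ-Solver.solve-∀

i*i≡∣i∣*∣i∣ : ∀ i → i ℤ.* i ≡ + (∣ i ∣ * ∣ i ∣)
i*i≡∣i∣*∣i∣ (+ n)    = sym (ℤ.pos-* n n)
i*i≡∣i∣*∣i∣ -[1+ n ] = refl

sum-of-squares≡0 : ∀ a b → a ℤ.* a ℤ.+ b ℤ.* b ≡ + 0 → a ≡ + 0 × b ≡ + 0
sum-of-squares≡0 a b eq = vanish a (m+n≡0⇒m≡0 (∣ a ∣ * ∣ a ∣) sum≡0) , vanish b (m+n≡0⇒n≡0 (∣ a ∣ * ∣ a ∣) sum≡0)
  where
  sum≡0 : ∣ a ∣ * ∣ a ∣ + ∣ b ∣ * ∣ b ∣ ≡ 0
  sum≡0 = ℤ.+-injective (trans (ℤ.pos-+ (∣ a ∣ * ∣ a ∣) (∣ b ∣ * ∣ b ∣)) (trans (cong₂ ℤ._+_ (sym (i*i≡∣i∣*∣i∣ a)) (sym (i*i≡∣i∣*∣i∣ b))) eq))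
  vanish : ∀ a → ∣ a ∣ * ∣ a ∣ ≡ 0 → a ≡ + 0
  vanish a ∣a∣²≡0 with m*n≡0⇒m≡0∨n≡0 ∣ a ∣ ∣a∣²≡0
  ... | inj₁ p = ℤ.∣i∣≡0⇒i≡0 p
  ... | inj₂ p = ℤ.∣i∣≡0⇒i≡0 p

square-from-ℤ : ∀ t r a → t ℤ.* t ≡ + (r * r * a) → 0 < r → Square a
square-from-ℤ t r a eq 0<r = square-*-cancel 0<r (∣ t ∣ , ℤ.+-injective (trans (sym (i*i≡∣i∣*∣i∣ t)) eq))

pos-** : ∀ a b c → + (a * b * c) ≡ + a ℤ.* + b ℤ.* + c
pos-** a b c = trans (ℤ.pos-* (a * b) c) (cong (ℤ._* + c) (ℤ.pos-* a b))

-- The conjugates of √A + (1 + A)√B are the roots r of squares-form.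
squares-form : ℤ → ℤ → ℤ → ℤ
squares-form r A B = let W = + 1 ℤ.+ A ; z = r ℤ.* r ⊖ A ⊖ W ℤ.* W ℤ.* B in
  z ℤ.* z ⊖ + 4 ℤ.* (W ℤ.* W) ℤ.* (A ℤ.* B)

-- `(2A + z)² = (2r)² A + squares-form r A B`, and similarly `(2W²B + z)²` for `B` with `2Wr`; so a
-- root `r` makes `A` and `B` squares once `r` is nonzero. At `r = 0` the form is `(A - W²B)²`, and
-- the weight `W = 1 + A` with `B` positive excludes `A = W²B`.
squares-form-sound : ∀ r A B → 0 < B → squares-form (+ r) (+ A) (+ B) ≡ + 0 → Square A × Square B
squares-form-sound r A B 0<B eq =
    square-from-ℤ (+ 2 ℤ.* + A ℤ.+ z) (2 * r) A
      (trans (idA (+ r) (+ A) (+ B)) (trans (cong (λ w → + 2 ℤ.* + r ℤ.* (+ 2 ℤ.* + r) ℤ.* + A ℤ.+ w) eq) (trans (ℤ.+-identityʳ _) posA))) (*-mono-≤ {1} {2} (s≤s z≤n) 0<r)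
  , square-from-ℤ (+ 2 ℤ.* (W ℤ.* W ℤ.* + B) ℤ.+ z) (2 * (1 + A) * r) B
      (trans (idB (+ r) (+ A) (+ B)) (trans (cong (λ w → + 2 ℤ.* W ℤ.* + r ℤ.* (+ 2 ℤ.* W ℤ.* + r) ℤ.* + B ℤ.+ w) eq) (trans (ℤ.+-identityʳ _) posB))) (*-mono-≤ {1} {2 * (1 + A)} (s≤s z≤n) 0<r)
  where
  W = + 1 ℤ.+ + A
  z = + r ℤ.* + r ⊖ + A ⊖ W ℤ.* W ℤ.* + B
  idA : ∀ r A B → let W = + 1 ℤ.+ A ; z = r ℤ.* r ⊖ A ⊖ W ℤ.* W ℤ.* B in
    (+ 2 ℤ.* A ℤ.+ z) ℤ.* (+ 2 ℤ.* A ℤ.+ z) ≡ + 2 ℤ.* r ℤ.* (+ 2 ℤ.* r) ℤ.* A ℤ.+ squares-form r A B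
  idA r A B = identity r A B (+ 1 ℤ.+ A)
    where
    identity : ∀ r A B W →
      (+ 2 ℤ.* A ℤ.+ (r ℤ.* r ℤ.+ ℤ.-1ℤ ℤ.* A ℤ.+ ℤ.-1ℤ ℤ.* (W ℤ.* W ℤ.* B))) ℤ.* (+ 2 ℤ.* A ℤ.+ (r ℤ.* r ℤ.+ ℤ.-1ℤ ℤ.* A ℤ.+ ℤ.-1ℤ ℤ.* (W ℤ.* W ℤ.* B)))
      ≡ + 2 ℤ.* r ℤ.* (+ 2 ℤ.* r) ℤ.* A
        ℤ.+ ((r ℤ.* r ℤ.+ ℤ.-1ℤ ℤ.* A ℤ.+ ℤ.-1ℤ ℤ.* (W ℤ.* W ℤ.* B)) ℤ.* (r ℤ.* r ℤ.+ ℤ.-1ℤ ℤ.* A ℤ.+ ℤ.-1ℤ ℤ.* (W ℤ.* W ℤ.* B))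
             ℤ.+ ℤ.-1ℤ ℤ.* (+ 4 ℤ.* (W ℤ.* W) ℤ.* (A ℤ.* B)))
    identity = ℤ-Solver.solve-∀
  idB : ∀ r A B → let W = + 1 ℤ.+ A ; z = r ℤ.* r ⊖ A ⊖ W ℤ.* W ℤ.* B in
    (+ 2 ℤ.* (W ℤ.* W ℤ.* B) ℤ.+ z) ℤ.* (+ 2 ℤ.* (W ℤ.* W ℤ.* B) ℤ.+ z) ≡ + 2 ℤ.* W ℤ.* r ℤ.* (+ 2 ℤ.* W ℤ.* r) ℤ.* B ℤ.+ squares-form r A B
  idB r A B = identity r A B (+ 1 ℤ.+ A)
    where
    identity : ∀ r A B W →
      (+ 2 ℤ.* (W ℤ.* W ℤ.* B) ℤ.+ (r ℤ.* r ℤ.+ ℤ.-1ℤ ℤ.* A ℤ.+ ℤ.-1ℤ ℤ.* (W ℤ.* W ℤ.* B))) ℤ.* (+ 2 ℤ.* (W ℤ.* W ℤ.* B) ℤ.+ (r ℤ.* r ℤ.+ ℤ.-1ℤ ℤ.* A ℤ.+ ℤ.-1ℤ ℤ.* (W ℤ.* W ℤ.* B)))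
      ≡ + 2 ℤ.* W ℤ.* r ℤ.* (+ 2 ℤ.* W ℤ.* r) ℤ.* B
        ℤ.+ ((r ℤ.* r ℤ.+ ℤ.-1ℤ ℤ.* A ℤ.+ ℤ.-1ℤ ℤ.* (W ℤ.* W ℤ.* B)) ℤ.* (r ℤ.* r ℤ.+ ℤ.-1ℤ ℤ.* A ℤ.+ ℤ.-1ℤ ℤ.* (W ℤ.* W ℤ.* B))
             ℤ.+ ℤ.-1ℤ ℤ.* (+ 4 ℤ.* (W ℤ.* W) ℤ.* (A ℤ.* B)))
    identity = ℤ-Solver.solve-∀
  posA : + 2 ℤ.* + r ℤ.* (+ 2 ℤ.* + r) ℤ.* + A ≡ + (2 * r * (2 * r) * A)
  posA = sym (trans (pos-** (2 * r) (2 * r) A) (cong (λ w → w ℤ.* w ℤ.* + A) (ℤ.pos-* 2 r)))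
  posB : + 2 ℤ.* W ℤ.* + r ℤ.* (+ 2 ℤ.* W ℤ.* + r) ℤ.* + B ≡ + (2 * (1 + A) * r * (2 * (1 + A) * r) * B)
  posB = sym (trans (pos-** (2 * (1 + A) * r) (2 * (1 + A) * r) B) (cong (λ w → w ℤ.* w ℤ.* + B) (pos-** 2 (1 + A) r)))
  0<r : 0 < r
  0<r = n≢0⇒n>0 λ r≡0 → <⇒≢ A<W²B (ℤ.+-injective (trans (A≡W²B r≡0) (sym (pos-** (1 + A) (1 + A) B))))
    where
    A<W²B : A < (1 + A) * (1 + A) * B
    A<W²B = <-≤-trans (n<1+n A) (≤-trans (m≤m*n (1 + A) (1 + A)) (m≤m*n ((1 + A) * (1 + A)) B {{>-nonZero 0<B}}))
    identity : ∀ A B W →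
      (A ℤ.+ ℤ.-1ℤ ℤ.* (W ℤ.* W ℤ.* B)) ℤ.* (A ℤ.+ ℤ.-1ℤ ℤ.* (W ℤ.* W ℤ.* B))
      ≡ (+ 0 ℤ.* + 0 ℤ.+ ℤ.-1ℤ ℤ.* A ℤ.+ ℤ.-1ℤ ℤ.* (W ℤ.* W ℤ.* B)) ℤ.* (+ 0 ℤ.* + 0 ℤ.+ ℤ.-1ℤ ℤ.* A ℤ.+ ℤ.-1ℤ ℤ.* (W ℤ.* W ℤ.* B))
        ℤ.+ ℤ.-1ℤ ℤ.* (+ 4 ℤ.* (W ℤ.* W) ℤ.* (A ℤ.* B))
    identity = ℤ-Solver.solve-∀
    A≡W²B : r ≡ 0 → + A ≡ W ℤ.* W ℤ.* + B
    A≡W²B r≡0 with ℤ.i*j≡0⇒i≡0∨j≡0 (+ A ⊖ W ℤ.* W ℤ.* + B)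
                     (trans (identity (+ A) (+ B) W) (subst (λ r → squares-form (+ r) (+ A) (+ B) ≡ + 0) r≡0 eq))
    ... | inj₁ p = ⊖≡0⇒≡ _ _ p
    ... | inj₂ p = ⊖≡0⇒≡ _ _ p

squares-form-complete : ∀ {A B} → Square A → Square B → ∃ λ r → squares-form (+ r) (+ A) (+ B) ≡ + 0
squares-form-complete (α , refl) (β , refl) = α + (1 + α * α) * β ,
  trans (cong₂ (λ r (A , B) → squares-form r A B)
          (trans (ℤ.pos-+ α ((1 + α * α) * β)) (cong (ℤ._+_ (+ α)) (trans (ℤ.pos-* (1 + α * α) β) (cong (λ A → (+ 1 ℤ.+ A) ℤ.* + β) (ℤ.pos-* α α)))))
          (cong₂ _,_ (ℤ.pos-* α α) (ℤ.pos-* β β)))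
        (identity (+ α) (+ β) (+ 1 ℤ.+ + α ℤ.* + α))
  where
  identity : ∀ α β W →
    ((α ℤ.+ W ℤ.* β) ℤ.* (α ℤ.+ W ℤ.* β) ℤ.+ ℤ.-1ℤ ℤ.* (α ℤ.* α) ℤ.+ ℤ.-1ℤ ℤ.* (W ℤ.* W ℤ.* (β ℤ.* β)))
    ℤ.* ((α ℤ.+ W ℤ.* β) ℤ.* (α ℤ.+ W ℤ.* β) ℤ.+ ℤ.-1ℤ ℤ.* (α ℤ.* α) ℤ.+ ℤ.-1ℤ ℤ.* (W ℤ.* W ℤ.* (β ℤ.* β)))
    ℤ.+ ℤ.-1ℤ ℤ.* (+ 4 ℤ.* (W ℤ.* W) ℤ.* (α ℤ.* α ℤ.* (β ℤ.* β))) ≡ + 0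
  identity = ℤ-Solver.solve-∀

-- A zero v = c (Z + 1 ± √Z) has the sign of c, so v ≥ 0 forces c > 0.
signed-square-form : ℤ → ℤ → ℤ → ℤ
signed-square-form v c Z = let t = v ⊖ c ℤ.* (Z ℤ.+ + 1) in t ℤ.* t ⊖ c ℤ.* c ℤ.* Z

signed-square-form-sound : ∀ v c Z → c ≢ + 0 → signed-square-form (+ v) c (+ Z) ≡ + 0 →
  Square Z × ∃ λ p → c ≡ + suc p
signed-square-form-sound v (+ 0) Z c≢0 eq = contradiction refl c≢0
signed-square-form-sound v c@(+ suc p) Z c≢0 eq =
  square-from-ℤ (+ v ⊖ c ℤ.* (+ Z ℤ.+ + 1)) (suc p) Z (trans (⊖≡0⇒≡ _ _ eq) (sym (pos-** (suc p) (suc p) Z))) z<s , p , refl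
-- For `c = -a` the inner term is `v + a (Z + 1)`, whose square exceeds `a² Z`.
signed-square-form-sound v c@(-[1+ p ]) Z c≢0 eq = contradiction (ℤ.+-injective τ²≡) (>⇒≢ a²Z<τ²)
  where
  a = suc p
  τ = v + a * (Z + 1)
  t≡ : + v ⊖ c ℤ.* (+ Z ℤ.+ + 1) ≡ + τ
  t≡ = trans (identity (+ v) (+ a) (+ Z ℤ.+ + 1)) (sym (trans (ℤ.pos-+ v (a * (Z + 1))) (cong (ℤ._+_ (+ v)) (trans (ℤ.pos-* a (Z + 1)) (cong (+ a ℤ.*_) (ℤ.pos-+ Z 1))))))
    where
    identity : ∀ v a s → v ℤ.+ ℤ.-1ℤ ℤ.* (ℤ.- a ℤ.* s) ≡ v ℤ.+ a ℤ.* s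
    identity = ℤ-Solver.solve-∀
  τ²≡ : + (τ * τ) ≡ + (a * a * Z)
  τ²≡ = trans (ℤ.pos-* τ τ) (trans (cong (λ w → w ℤ.* w) (sym t≡)) (trans (⊖≡0⇒≡ _ _ eq) (sym (pos-** a a Z))))
  a²Z<τ² : a * a * Z < τ * τ
  a²Z<τ² = begin-strict
    a * a * Z                          <⟨ *-monoʳ-< (a * a) (≤-reflexive (+-comm 1 Z)) ⟩
    a * a * (Z + 1)                    ≤⟨ *-monoʳ-≤ (a * a) (m≤m*n (Z + 1) (Z + 1) {{>-nonZero (m≤n+m 1 Z)}}) ⟩
    a * a * ((Z + 1) * (Z + 1))        ≡⟨ interchange a (Z + 1) ⟩
    a * (Z + 1) * (a * (Z + 1))        ≤⟨ *-mono-≤ (m≤n+m _ v) (m≤n+m _ v) ⟩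
    τ * τ                              ∎
    where
    open ≤-Reasoning
    interchange : ∀ a b → a * a * (b * b) ≡ a * b * (a * b)
    interchange = solve-∀

signed-square-form-complete : ∀ {Z} p → Square Z → ∃ λ v → signed-square-form (+ v) (+ p) (+ Z) ≡ + 0
signed-square-form-complete p (ρ , refl) = p * (ρ * ρ + 1 + ρ) ,
  trans (cong₂ (λ v Z → signed-square-form v (+ p) Z)
          (trans (ℤ.pos-* p (ρ * ρ + 1 + ρ)) (cong (+ p ℤ.*_) (trans (ℤ.pos-+ (ρ * ρ + 1) ρ) (cong (ℤ._+ + ρ) (trans (ℤ.pos-+ (ρ * ρ) 1) (cong (ℤ._+ + 1) (ℤ.pos-* ρ ρ)))))))
          (ℤ.pos-* ρ ρ))
        (identity (+ p) (+ ρ))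
  where
  identity : ∀ p ρ →
    (p ℤ.* (ρ ℤ.* ρ ℤ.+ + 1 ℤ.+ ρ) ℤ.+ ℤ.-1ℤ ℤ.* (p ℤ.* (ρ ℤ.* ρ ℤ.+ + 1)))
    ℤ.* (p ℤ.* (ρ ℤ.* ρ ℤ.+ + 1 ℤ.+ ρ) ℤ.+ ℤ.-1ℤ ℤ.* (p ℤ.* (ρ ℤ.* ρ ℤ.+ + 1)))
    ℤ.+ ℤ.-1ℤ ℤ.* (p ℤ.* p ℤ.* (ρ ℤ.* ρ)) ≡ + 0
  identity = ℤ-Solver.solve-∀

-- Positive exactly when 0 < y and qLP < K < qLP + LP.
gap : ℤ → ℤ → ℤ → ℤ → ℤ
gap y K qLP LP = y ℤ.* ((K ⊖ qLP) ℤ.* (LP ⊖ (K ⊖ qLP)))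

-- In `gap` the two factors add up to `LP`, which is not negative; this rules out that both are
-- negative.
positive-factors : ∀ {a b m} p → a ℤ.* b ≡ + suc p → a ℤ.+ b ≡ + m → (∃ λ α → a ≡ + suc α) × (∃ λ β → b ≡ + suc β)
positive-factors {+ 0}       {b}         p () _
positive-factors {+ suc α}   {+ 0}       p ab _ = contradiction (trans (sym ab) (ℤ.*-zeroʳ (+ suc α))) λ ()
positive-factors {+ suc α}   {+ suc β}   p _ _ = (α , refl) , (β , refl)
positive-factors {+ suc α}   { -[1+ β ]} p () _
positive-factors { -[1+ α ]} {+ 0}       p ab _ = contradiction (trans (sym ab) (ℤ.*-zeroʳ -[1+ α ])) λ ()
positive-factors { -[1+ α ]} {+ suc β}   p () _
positive-factors { -[1+ α ]} { -[1+ β ]} p _ ()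

⊖≡+suc⇒< : ∀ {m n p} → + m ⊖ + n ≡ + suc p → n < m
⊖≡+suc⇒< {m} {n} {p} eq = subst (n <_) (sym (ℤ.+-injective (trans (expand (+ m) (+ n)) (trans (cong (ℤ._+ + n) eq) (sym (ℤ.pos-+ (suc p) n)))))) (m<n+m n z<s)
  where
  expand : ∀ a b → a ≡ (a ℤ.+ ℤ.-1ℤ ℤ.* b) ℤ.+ b
  expand = ℤ-Solver.solve-∀

<⇒⊖≡+suc : ∀ {m n} → n < m → ∃ λ p → + m ⊖ + n ≡ + suc p
<⇒⊖≡+suc {m} {n} n<m with m ∸ suc n | m+[n∸m]≡n n<m
... | p | refl = p , trans (cong (_⊖ + n) (trans (cong +_ (sym (+-suc n p))) (ℤ.pos-+ n (suc p)))) (cancel (+ n) (+ suc p))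
  where
  cancel : ∀ n p → n ℤ.+ p ℤ.+ ℤ.-1ℤ ℤ.* n ≡ p
  cancel = ℤ-Solver.solve-∀

⊖-⊖ : ∀ LP K qLP → LP ⊖ (K ⊖ qLP) ≡ (LP ℤ.+ qLP) ⊖ K
⊖-⊖ = identity
  where
  identity : ∀ LP K qLP → LP ℤ.+ ℤ.-1ℤ ℤ.* (K ℤ.+ ℤ.-1ℤ ℤ.* qLP) ≡ LP ℤ.+ qLP ℤ.+ ℤ.-1ℤ ℤ.* K
  identity = ℤ-Solver.solve-∀

gap-sound : ∀ y K qLP LP {p} → gap (+ y) (+ K) (+ qLP) (+ LP) ≡ + suc p → 0 < y × qLP < K × K < LP + qLP
gap-sound zero K qLP LP ()
gap-sound y@(suc y′) K qLP LP {p} eq = z<s , conclude _ refl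
  where
  sum : ∀ a b → a ℤ.+ (b ℤ.+ ℤ.-1ℤ ℤ.* a) ≡ b
  sum = ℤ-Solver.solve-∀
  a = + K ⊖ + qLP
  b = + LP ⊖ a
  conclude : ∀ c → a ℤ.* b ≡ c → qLP < K × K < LP + qLP
  conclude (+ 0)      ab = contradiction (trans (sym eq) (trans (cong (+ y ℤ.*_) ab) (ℤ.*-zeroʳ (+ y)))) λ ()
  conclude -[1+ _ ]   ab = contradiction (trans (sym eq) (cong (+ y ℤ.*_) ab)) λ ()
  conclude (+ suc p′) ab with positive-factors p′ ab (sum a (+ LP))
  ... | (_ , a≡) , (_ , b≡) = ⊖≡+suc⇒< a≡ ,
        ⊖≡+suc⇒< (trans (cong (_⊖ + K) (ℤ.pos-+ LP qLP)) (trans (sym (⊖-⊖ (+ LP) (+ K) (+ qLP))) b≡))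

gap-complete : ∀ {y K qLP LP} → 0 < y → qLP < K → K < LP + qLP → ∃ λ p → gap (+ y) (+ K) (+ qLP) (+ LP) ≡ + suc p
gap-complete {suc y} {K} {qLP} {LP} _ qLP<K K<
  with α , a≡ ← <⇒⊖≡+suc qLP<K | β , b≡ ← <⇒⊖≡+suc K< =
  _ , cong₂ (λ a b → + suc y ℤ.* (a ℤ.* b)) a≡ (trans (⊖-⊖ (+ LP) (+ K) (+ qLP)) (trans (cong (_⊖ + K) (sym (ℤ.pos-+ LP qLP))) b≡))

-- With `c = 0` the signed form would have the root `v = 0` for every `Z`. `2i - 1` never vanishes
-- and is positive exactly when `i` is.
odd : ℤ → ℤ
odd i = + 2 ℤ.* i ⊖ + 1

odd-+suc : ∀ p → ∃ λ r → odd (+ suc p) ≡ + suc r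
odd-+suc p = p + p , trans (identity (+ p)) (cong (ℤ._+_ (+ 1)) (sym (ℤ.pos-+ p p)))
  where
  identity : ∀ p → + 2 ℤ.* (+ 1 ℤ.+ p) ℤ.+ ℤ.-1ℤ ℤ.* + 1 ≡ + 1 ℤ.+ (p ℤ.+ p)
  identity = ℤ-Solver.solve-∀

odd≢0 : ∀ i → odd i ≢ + 0
odd≢0 (+ 0)     ()
odd≢0 (+ suc p) eq = contradiction (trans (sym (proj₂ (odd-+suc p))) eq) λ ()
odd≢0 -[1+ p ]  ()

odd-positive : ∀ {i p} → odd i ≡ + suc p → ∃ λ p → i ≡ + suc p
odd-positive {+ 0}      ()
odd-positive {+ suc p}  _ = p , refl
odd-positive { -[1+ p ]} ()

-- Transfer between polynomials and numbers

-- A parametricity argument: a relation respected by the three operations is respected by every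
-- expression built from them. It is applied to evaluation of a polynomial to a natural number.
module Related {A B : Set} (opsA : Ops A) (opsB : Ops B) (_~_ : A → B → Set)
  (lit~ : ∀ a → Ops.lit opsA a ~ Ops.lit opsB a)
  (_∔~_ : ∀ {a b a′ b′} → a ~ a′ → b ~ b′ → Ops._∔_ opsA a b ~ Ops._∔_ opsB a′ b′)
  (_·~_ : ∀ {a b a′ b′} → a ~ a′ → b ~ b′ → Ops._·_ opsA a b ~ Ops._·_ opsB a′ b′) where

  δ~ : ∀ {a a′} → a ~ a′ → Ops.δ opsA a ~ Ops.δ opsB a′
  δ~ a~ = a~ ·~ (lit~ 2 ∔~ a~)

  2+~ : ∀ {e e′} → e ~ e′ → Ops._∔_ opsA (Ops.lit opsA 2) e ~ Ops._∔_ opsB (Ops.lit opsB 2) e′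
  2+~ e~ = lit~ 2 ∔~ e~

  +·~ : ∀ {u e k u′ e′ k′} → u ~ u′ → e ~ e′ → k ~ k′ →
    Ops._∔_ opsA u (Ops._·_ opsA e k) ~ Ops._∔_ opsB u′ (Ops._·_ opsB e′ k′)
  +·~ u~ e~ k~ = u~ ∔~ (e~ ·~ k~)

  module TowerRelated {n d K S i j n′ d′ K′ S′ i′ j′}
    (n~ : n ~ n′) (d~ : d ~ d′) (K~ : K ~ K′) (S~ : S ~ S′) (i~ : i ~ i′) (j~ : j ~ j′) where
    private
      module α = Tower opsA n d K S i j
      module β = Tower opsB n′ d′ K′ S′ i′ j′
    D~ : α.D ~ β.D
    D~ = (δ~ d~ ·~ (K~ ·~ K~)) ∔~ lit~ 1
    B~ : α.B ~ β.B
    B~ = (K~ ∔~ K~) ·~ (S~ ·~ D~)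
    E~ : α.E ~ β.E
    E~ = (B~ ·~ K~) ·~ (lit~ 1 ∔~ i~)
    V~ : α.V ~ β.V
    V~ = δ~ d~ ·~ (E~ ·~ E~)
    F~ : α.F ~ β.F
    F~ = V~ ∔~ lit~ 1
    b~ : α.b ~ β.b
    b~ = d~ ·~ (V~ ·~ V~)
    t~ : α.t ~ β.t
    t~ = K~ ∔~ (F~ ·~ (((lit~ 1 ∔~ n~) ∔~ K~) ∔~ ((K~ ∔~ K~) ·~ j~)))
    I~ : α.I ~ β.I
    I~ = (δ~ b~ ·~ (t~ ·~ t~)) ∔~ lit~ 1
    Z~ : Tower.Z opsA n d K S i j ~ Tower.Z opsB n′ d′ K′ S′ i′ j′
    Z~ = (S~ ·~ D~) ·~ (F~ ·~ I~)

  module RatioRelated {y c s u R l m v y′ c′ s′ u′ R′ l′ m′ v′}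
    (y~ : y ~ y′) (c~ : c ~ c′) (s~ : s ~ s′) (u~ : u ~ u′) (R~ : R ~ R′) (l~ : l ~ l′) (m~ : m ~ m′) (v~ : v ~ v′) where
    private
      module α = Ratio opsA y c s u R l m v
      module β = Ratio opsB y′ c′ s′ u′ R′ l′ m′ v′
    L~ : α.L ~ β.L
    L~ = (lit~ 1 ∔~ c~) ∔~ (R~ ·~ l~)
    P~ : α.P ~ β.P
    P~ = (lit~ 1 ∔~ s~) ∔~ ((R~ ·~ u~) ·~ m~)
    D₂~ : Ratio.D₂ opsA y c s u R l m v ~ Ratio.D₂ opsB y′ c′ s′ u′ R′ l′ m′ v′
    D₂~ = (δ~ R~ ·~ (L~ ·~ L~)) ∔~ lit~ 1
    D₃~ : Ratio.D₃ opsA y c s u R l m v ~ Ratio.D₃ opsB y′ c′ s′ u′ R′ l′ m′ v′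
    D₃~ = (δ~ (R~ ·~ u~) ·~ (P~ ·~ P~)) ∔~ lit~ 1
    LP~ : Ratio.LP opsA y c s u R l m v ~ Ratio.LP opsB y′ c′ s′ u′ R′ l′ m′ v′
    LP~ = L~ ·~ P~
    q~ : Ratio.q opsA y c s u R l m v ~ Ratio.q opsB y′ c′ s′ u′ R′ l′ m′ v′
    q~ = (v~ ·~ u~) ∔~ y~

  module BaseRelated {y n x w y′ n′ x′ w′} (y~ : y ~ y′) (n~ : n ~ n′) (x~ : x ~ x′) (w~ : w ~ w′) where
    private
      module α = Base opsA y n x w
      module β = Base opsB y′ n′ x′ w′
    u₀~ : α.u₀ ~ β.u₀
    u₀~ = (y~ ∔~ n~) ∔~ x~
    u~ : Base.u opsA y n x w ~ Base.u opsB y′ n′ x′ w′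
    u~ = lit~ 1 ∔~ u₀~
    g~ : α.g ~ β.g
    g~ = lit~ 2 ∔~ (u~ ∔~ n~)
    G~ : α.G ~ β.G
    G~ = g~ ·~ (lit~ 1 ∔~ w~)
    T~ : α.T ~ β.T
    T~ = δ~ g~ ·~ (G~ ·~ G~)
    S~ : Base.S opsA y n x w ~ Base.S opsB y′ n′ x′ w′
    S~ = T~ ∔~ lit~ 1
    R₀~ : α.R₀ ~ β.R₀
    R₀~ = (w~ ∔~ T~) ∔~ (w~ ·~ T~)
    R~ : Base.R opsA y n x w ~ Base.R opsB y′ n′ x′ w′
    R~ = lit~ 1 ∔~ R₀~
    e~ : Base.e opsA y n x w ~ Base.e opsB y′ n′ x′ w′
    e~ = u₀~ ∔~ (R₀~ ·~ (lit~ 1 ∔~ u~))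

-- The polynomial and its evaluation

Poly-ops : Ops (Poly 13)
Poly-ops = record { lit = λ a → const (+ a) ; _∔_ = _⊕_ ; _·_ = _⊗_ }

infixl 6 _⊖ᵖ_
_⊖ᵖ_ : Poly 13 → Poly 13 → Poly 13
p ⊖ᵖ q = p ⊕ (const ℤ.-1ℤ ⊗ q)

squares-poly : Poly 13 → Poly 13 → Poly 13 → Poly 13
squares-poly r A B =
  let W = const (+ 1) ⊕ A ; z = ((r ⊗ r) ⊖ᵖ A) ⊖ᵖ ((W ⊗ W) ⊗ B) in
  (z ⊗ z) ⊖ᵖ ((const (+ 4) ⊗ (W ⊗ W)) ⊗ (A ⊗ B))

signed-square-poly : Poly 13 → Poly 13 → Poly 13 → Poly 13
signed-square-poly v c Z = let t = v ⊖ᵖ (c ⊗ (Z ⊕ const (+ 1))) in (t ⊗ t) ⊖ᵖ ((c ⊗ c) ⊗ Z)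

odd-gap-poly : Poly 13 → Poly 13 → Poly 13 → Poly 13 → Poly 13
odd-gap-poly y K qLP LP =
  (const (+ 2) ⊗ (y ⊗ ((K ⊖ᵖ qLP) ⊗ (LP ⊖ᵖ (K ⊖ᵖ qLP))))) ⊖ᵖ const (+ 1)

-- A record, so that polynomials are compared without evaluating them.
record _⊢_⇓_ (ρ : Fin 13 → ℕ) (p : Poly 13) (a : ℤ) : Set where
  constructor evaluates
  field
    eval≡ : evalℕ p ρ ≡ a

module _ {ρ : Fin 13 → ℕ} where

  infixl 6 _⊕⇓_ _⊖⇓_
  infixl 7 _⊗⇓_

  const⇓ : ∀ a → ρ ⊢ const a ⇓ a
  const⇓ a = evaluates refl

  _⊕⇓_ : ∀ {p q a b} → ρ ⊢ p ⇓ a → ρ ⊢ q ⇓ b → ρ ⊢ p ⊕ q ⇓ (a ℤ.+ b)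
  evaluates p ⊕⇓ evaluates q = evaluates (cong₂ ℤ._+_ p q)

  _⊗⇓_ : ∀ {p q a b} → ρ ⊢ p ⇓ a → ρ ⊢ q ⇓ b → ρ ⊢ p ⊗ q ⇓ (a ℤ.* b)
  evaluates p ⊗⇓ evaluates q = evaluates (cong₂ ℤ._*_ p q)

  _⊖⇓_ : ∀ {p q a b} → ρ ⊢ p ⇓ a → ρ ⊢ q ⇓ b → ρ ⊢ p ⊖ᵖ q ⇓ (a ⊖ b)
  p ⊖⇓ q = p ⊕⇓ const⇓ ℤ.-1ℤ ⊗⇓ q

  squares⇓ : ∀ {r A B r′ A′ B′} → ρ ⊢ r ⇓ r′ → ρ ⊢ A ⇓ A′ → ρ ⊢ B ⇓ B′ →
    ρ ⊢ squares-poly r A B ⇓ squares-form r′ A′ B′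
  squares⇓ r A B = z ⊗⇓ z ⊖⇓ const⇓ (+ 4) ⊗⇓ (W ⊗⇓ W) ⊗⇓ (A ⊗⇓ B)
    where
    W = const⇓ (+ 1) ⊕⇓ A
    z = r ⊗⇓ r ⊖⇓ A ⊖⇓ W ⊗⇓ W ⊗⇓ B

  signed-square⇓ : ∀ {v c Z v′ c′ Z′} → ρ ⊢ v ⇓ v′ → ρ ⊢ c ⇓ c′ → ρ ⊢ Z ⇓ Z′ →
    ρ ⊢ signed-square-poly v c Z ⇓ signed-square-form v′ c′ Z′
  signed-square⇓ v c Z = t ⊗⇓ t ⊖⇓ c ⊗⇓ c ⊗⇓ Z
    where
    t = v ⊖⇓ c ⊗⇓ (Z ⊕⇓ const⇓ (+ 1))

  odd-gap⇓ : ∀ {y K qLP LP y′ K′ qLP′ LP′} → ρ ⊢ y ⇓ y′ → ρ ⊢ K ⇓ K′ → ρ ⊢ qLP ⇓ qLP′ → ρ ⊢ LP ⇓ LP′ →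
    ρ ⊢ odd-gap-poly y K qLP LP ⇓ odd (gap y′ K′ qLP′ LP′)
  odd-gap⇓ y K qLP LP = const⇓ (+ 2) ⊗⇓ (y ⊗⇓ ((K ⊖⇓ qLP) ⊗⇓ (LP ⊖⇓ (K ⊖⇓ qLP)))) ⊖⇓ const⇓ (+ 1)

opaque
  combined-poly : (v₂ v₃ y K q LP Z D₂ D₃ : Poly 13) → Poly 13
  combined-poly v₂ v₃ y K q LP Z D₂ D₃ =
    let p₁ = signed-square-poly v₂ (odd-gap-poly y K (q ⊗ LP) LP) Z ; p₂ = squares-poly v₃ D₂ D₃ in
    (p₁ ⊗ p₁) ⊕ (p₂ ⊗ p₂)

  combined-form : (v₂ v₃ y K q LP Z D₂ D₃ : ℕ) → ℤ
  combined-form v₂ v₃ y K q LP Z D₂ D₃ =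
    let p₁ = signed-square-form (+ v₂) (odd (gap (+ y) (+ K) (+ q ℤ.* + LP) (+ LP))) (+ Z) ; p₂ = squares-form (+ v₃) (+ D₂) (+ D₃) in
    p₁ ℤ.* p₁ ℤ.+ p₂ ℤ.* p₂

  combined⇓ : ∀ {ρ v₂ v₃ y K q LP Z D₂ D₃ v₂′ v₃′ y′ K′ q′ LP′ Z′ D₂′ D₃′} →
    ρ ⊢ v₂ ⇓ (+ v₂′) → ρ ⊢ v₃ ⇓ (+ v₃′) → ρ ⊢ y ⇓ (+ y′) → ρ ⊢ K ⇓ (+ K′) → ρ ⊢ q ⇓ (+ q′) →
    ρ ⊢ LP ⇓ (+ LP′) → ρ ⊢ Z ⇓ (+ Z′) → ρ ⊢ D₂ ⇓ (+ D₂′) → ρ ⊢ D₃ ⇓ (+ D₃′) →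
    ρ ⊢ combined-poly v₂ v₃ y K q LP Z D₂ D₃ ⇓ combined-form v₂′ v₃′ y′ K′ q′ LP′ Z′ D₂′ D₃′
  combined⇓ v₂ v₃ y K q LP Z D₂ D₃ =
    let p₁ = signed-square⇓ v₂ (odd-gap⇓ y K (q ⊗⇓ LP) LP) Z
        p₂ = squares⇓ v₃ D₂ D₃
    in p₁ ⊗⇓ p₁ ⊕⇓ p₂ ⊗⇓ p₂

  combined-sound : ∀ {v₂ v₃ y K q LP Z D₂ D₃} → 0 < D₃ → combined-form v₂ v₃ y K q LP Z D₂ D₃ ≡ + 0 →
    Square Z × Square D₂ × Square D₃ × 0 < y × q * LP < K × K < suc q * LP
  combined-sound {v₂} {v₃} {y} {K} {q} {LP} {Z} {D₂} {D₃} 0<D₃ eq =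
    let c = odd (gap (+ y) (+ K) (+ q ℤ.* + LP) (+ LP))
        e₁ , e₂ = sum-of-squares≡0 (signed-square-form (+ v₂) c (+ Z)) (squares-form (+ v₃) (+ D₂) (+ D₃)) eq
        Z□ , _ , c≡ = signed-square-form-sound v₂ c Z (odd≢0 (gap (+ y) (+ K) (+ q ℤ.* + LP) (+ LP))) e₁
        p , gap≡ = odd-positive c≡
        D₂□ , D₃□ = squares-form-sound v₃ D₂ D₃ 0<D₃ e₂
        0<y , qLP<K , K< = gap-sound y K (q * LP) LP {p} (trans (cong (λ a → gap (+ y) (+ K) a (+ LP)) (ℤ.pos-* q LP)) gap≡)
    in Z□ , D₂□ , D₃□ , 0<y , qLP<K , K<

  combined-complete : ∀ {y K q LP Z D₂ D₃} → Square Z × Square D₂ × Square D₃ × 0 < y × q * LP < K × K < suc q * LP →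
    ∃₂ λ v₂ v₃ → combined-form v₂ v₃ y K q LP Z D₂ D₃ ≡ + 0
  combined-complete {y} {K} {q} {LP} {Z} {D₂} {D₃} (Z□ , D₂□ , D₃□ , 0<y , qLP<K , K<) =
    let p , gap≡ = gap-complete {y} {K} {q * LP} {LP} 0<y qLP<K K<
        r , odd≡ = odd-+suc p
        c≡ = trans (cong odd (trans (cong (λ a → gap (+ y) (+ K) a (+ LP)) (sym (ℤ.pos-* q LP))) gap≡)) odd≡
        v₂ , e₁ = signed-square-form-complete (suc r) Z□
        v₃ , e₂ = squares-form-complete D₂□ D₃□
    in v₂ , v₃ , cong₂ (λ a b → a ℤ.* a ℤ.+ b ℤ.* b) (trans (cong (λ c → signed-square-form (+ v₂) c (+ Z)) c≡) e₁) e₂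

module Related-⇓ (ρ : Fin 13 → ℕ) where

  open Related Poly-ops ℕ-ops (λ p a → ρ ⊢ p ⇓ (+ a)) (λ a → evaluates refl)
    (λ {p} {q} {a} {b} p~ q~ → subst (ρ ⊢ p ⊕ q ⇓_) (sym (ℤ.pos-+ a b)) (p~ ⊕⇓ q~))
    (λ {p} {q} {a} {b} p~ q~ → subst (ρ ⊢ p ⊗ q ⇓_) (sym (ℤ.pos-* a b)) (p~ ⊗⇓ q~)) public


-- Opaque, so that instances are compared by their arguments instead of being evaluated.
opaque
  final-poly : (y n c s u R e S k l m i j v v₂ v₃ : Poly 13) → Poly 13
  final-poly y n c s u R e S k l m i j v v₂ v₃ =
    combined-poly v₂ v₃ y (u ⊕ (e ⊗ k)) q LP (Tower.Z Poly-ops n (const (+ 2) ⊕ e) (u ⊕ (e ⊗ k)) S i j) D₂ D₃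
    where open Ratio Poly-ops y c s u R l m v

  final-form : (y n c s u R e S k l m i j v v₂ v₃ : ℕ) → ℤ
  final-form y n c s u R e S k l m i j v v₂ v₃ =
    combined-form v₂ v₃ y (u + e * k) q LP (Tower.Z ℕ-ops n (2 + e) (u + e * k) S i j) D₂ D₃
    where open Ratio ℕ-ops y c s u R l m v

  final⇓ : ∀ {ρ y n c s u R e S k l m i j v v₂ v₃ y′ n′ c′ s′ u′ R′ e′ S′ k′ l′ m′ i′ j′ v′ v₂′ v₃′} →
    ρ ⊢ y ⇓ (+ y′) → ρ ⊢ n ⇓ (+ n′) → ρ ⊢ c ⇓ (+ c′) → ρ ⊢ s ⇓ (+ s′) →
    ρ ⊢ u ⇓ (+ u′) → ρ ⊢ R ⇓ (+ R′) → ρ ⊢ e ⇓ (+ e′) → ρ ⊢ S ⇓ (+ S′) →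
    ρ ⊢ k ⇓ (+ k′) → ρ ⊢ l ⇓ (+ l′) → ρ ⊢ m ⇓ (+ m′) → ρ ⊢ i ⇓ (+ i′) → ρ ⊢ j ⇓ (+ j′) →
    ρ ⊢ v ⇓ (+ v′) → ρ ⊢ v₂ ⇓ (+ v₂′) → ρ ⊢ v₃ ⇓ (+ v₃′) →
    ρ ⊢ final-poly y n c s u R e S k l m i j v v₂ v₃ ⇓ final-form y′ n′ c′ s′ u′ R′ e′ S′ k′ l′ m′ i′ j′ v′ v₂′ v₃′
  final⇓ {ρ} {u = u} {e = e} {k = k} {u′ = u′} {e′ = e′} {k′ = k′} y~ n~ c~ s~ u~ R~ e~ S~ k~ l~ m~ i~ j~ v~ v₂~ v₃~ =
    combined⇓ v₂~ v₃~ y~ K~ q~ LP~ (Z~ n~ d~ K~ S~ i~ j~) D₂~ D₃~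
    where
    open Related-⇓ ρ
    open RatioRelated y~ c~ s~ u~ R~ l~ m~ v~
    open TowerRelated using (Z~)
    K~ : ρ ⊢ u ⊕ (e ⊗ k) ⇓ (+ (u′ + e′ * k′))
    K~ = +·~ u~ e~ k~
    d~ : ρ ⊢ const (+ 2) ⊕ e ⇓ (+ (2 + e′))
    d~ = 2+~ e~

  final-sound : ∀ {y n c s u R e S k l m i j v v₂ v₃} → final-form y n c s u R e S k l m i j v v₂ v₃ ≡ + 0 → Solves y n c s u R e S k l m i j v
  final-sound {v₂ = v₂} {v₃} eq =
    let Z□ , D₂□ , D₃□ , 0<y , qLP<K , K<qLP = combined-sound {v₂} {v₃} (m≤n+m 1 _) eq
    in record { Z□ = Z□ ; D₂□ = D₂□ ; D₃□ = D₃□ ; 0<y = 0<y ; qLP<K = qLP<K ; K<qLP = K<qLP }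

  final-complete : ∀ {y n c s u R e S k l m i j v} → Solves y n c s u R e S k l m i j v →
    ∃₂ λ v₂ v₃ → final-form y n c s u R e S k l m i j v v₂ v₃ ≡ + 0
  final-complete sol = combined-complete (Z□ , D₂□ , D₃□ , 0<y , qLP<K , K<qLP)
    where open Solves sol

-- Variable order: y n s x w k l m i j v₁ v₂ v₃.
binomial-poly : Poly 13
binomial-poly = final-poly (var (# 0)) (var (# 1)) (var (# 1) ⊖ᵖ var (# 2)) (var (# 2))
  (Base.u Poly-ops y n x w) (Base.R Poly-ops y n x w) (Base.e Poly-ops y n x w) (Base.S Poly-ops y n x w)
  (var (# 5)) (var (# 6)) (var (# 7)) (var (# 8)) (var (# 9)) (var (# 10)) (var (# 11)) (var (# 12))
  where
  y n x w : Poly 13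
  y = var (# 0)
  n = var (# 1)
  x = var (# 3)
  w = var (# 4)

binomial-form : (y n s x w k l m i j v₁ v₂ v₃ : ℕ) → ℤ
binomial-form y n s x w k l m i j v₁ v₂ v₃ =
  final-form y n (n ∸ s) s (Base.u ℕ-ops y n x w) (Base.R ℕ-ops y n x w) (Base.e ℕ-ops y n x w) (Base.S ℕ-ops y n x w) k l m i j v₁ v₂ v₃

evalℕ-binomial-poly : ∀ y n s x w k l m i j v₁ v₂ v₃ → s ≤ n →
  evalℕ binomial-poly (lookup (y ∷ n ∷ s ∷ x ∷ w ∷ k ∷ l ∷ m ∷ i ∷ j ∷ v₁ ∷ v₂ ∷ v₃ ∷ []))
  ≡ binomial-form y n s x w k l m i j v₁ v₂ v₃
evalℕ-binomial-poly y n s x w k l m i j v₁ v₂ v₃ s≤n =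
  _⊢_⇓_.eval≡ (final⇓ {ρ} var⇓ var⇓ c~ var⇓ u~ R~ e~ S~ var⇓ var⇓ var⇓ var⇓ var⇓ var⇓ var⇓ var⇓)
  where
  ρ : Fin 13 → ℕ
  ρ = lookup (y ∷ n ∷ s ∷ x ∷ w ∷ k ∷ l ∷ m ∷ i ∷ j ∷ v₁ ∷ v₂ ∷ v₃ ∷ [])
  var⇓ : ∀ {a} → ρ ⊢ var a ⇓ (+ ρ a)
  var⇓ = evaluates refl
  -- The polynomial contains the integer difference of `n` and `s`; by `s ≤ n` it is the natural
  -- number `n ∸ s`.
  c~ : ρ ⊢ var (# 1) ⊖ᵖ var (# 2) ⇓ (+ (n ∸ s))
  c~ = evaluates (trans (cong (λ a → a ⊖ + s) (trans (cong +_ (sym (m∸n+n≡m s≤n))) (ℤ.pos-+ (n ∸ s) s))) (cancel (+ (n ∸ s)) (+ s)))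
    where
    cancel : ∀ a b → a ℤ.+ b ℤ.+ ℤ.-1ℤ ℤ.* b ≡ a
    cancel = ℤ-Solver.solve-∀
  open Related-⇓ ρ
  open BaseRelated {var (# 0)} {var (# 1)} {var (# 3)} {var (# 4)} {y} {n} {x} {w} var⇓ var⇓ var⇓ var⇓

binomial-sound : ∀ {y n s x w k l m i j v₁ v₂ v₃} → 0 < s → s ≤ n → binomial-form y n s x w k l m i j v₁ v₂ v₃ ≡ + 0 → y ≡ n C s
binomial-sound {y} {n} {s} {x} {w} {v₂ = v₂} {v₃} 0<s s≤n eq =
  solves-sound (sym (m∸n+n≡m s≤n)) 0<s S∣d 0<S n<u y<u R≤e d-product
    (λ S□ → R-large (pell-growth (Base.g ℕ-ops y n x w) (1 + w) z<s z<s S□)) (final-sound {v₂ = v₂} {v₃} eq)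
  where open BaseProperties y n x w

binomial-complete : ∀ {y n s} → 0 < s → s ≤ n → y ≡ n C s →
  ∃[ x ] ∃[ w ] ∃[ k ] ∃[ l ] ∃[ m ] ∃[ i ] ∃[ j ] ∃[ v₁ ] ∃[ v₂ ] ∃[ v₃ ] binomial-form y n s x w k l m i j v₁ v₂ v₃ ≡ + 0
binomial-complete {y} {n} {s} 0<s s≤n y≡ = extend (base-complete (<-≤-trans 0<s s≤n) (subst (_≤ 2 ^ n) (sym y≡) (C≤2^ n s)))
  where
  solve : ∀ x w → Base.u ℕ-ops y n x w ≡ Y 2 (1 + n) → Square (Base.S ℕ-ops y n x w) →
    ∃ λ k → ∃₂ λ l m → ∃₂ λ i j → ∃ λ v →
      Solves y n (n ∸ s) s (Base.u ℕ-ops y n x w) (Base.R ℕ-ops y n x w) (Base.e ℕ-ops y n x w) (Base.S ℕ-ops y n x w) k l m i j v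
  solve x w u≡ S□ = solves-complete (sym (m∸n+n≡m s≤n)) y≡ 0<s s≤n S∣d 0<S n<u d-product
    (R-large (pell-growth (Base.g ℕ-ops y n x w) (1 + w) z<s z<s S□)) S□ u≡
    where open BaseProperties y n x w
  conclude : ∀ x w →
    (∃ λ k → ∃₂ λ l m → ∃₂ λ i j → ∃ λ v →
      Solves y n (n ∸ s) s (Base.u ℕ-ops y n x w) (Base.R ℕ-ops y n x w) (Base.e ℕ-ops y n x w) (Base.S ℕ-ops y n x w) k l m i j v) →
    ∃[ k ] ∃[ l ] ∃[ m ] ∃[ i ] ∃[ j ] ∃[ v₁ ] ∃[ v₂ ] ∃[ v₃ ] binomial-form y n s x w k l m i j v₁ v₂ v₃ ≡ + 0
  conclude x w (k , l , m , i , j , v₁ , sol) = let v₂ , v₃ , eq = final-complete sol in k , l , m , i , j , v₁ , v₂ , v₃ , eq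
  extend : (∃₂ λ x w → Base.u ℕ-ops y n x w ≡ Y 2 (1 + n) × Square (Base.S ℕ-ops y n x w)) → _
  extend (x , w , u≡ , S□) = x , w , conclude x w (solve x w u≡ S□)

theorem7 : Σ (Poly 13) λ F →
    (y n s : ℕ) → 0 < s → s ≤ n →
    (y ≡ n C s) ⇔
    (∃[ x ] ∃[ w ] ∃[ k ] ∃[ l ] ∃[ m ] ∃[ i ] ∃[ j ] ∃[ v₁ ] ∃[ v₂ ] ∃[ v₃ ]
    (evalℕ F (lookup (y ∷ n ∷ s ∷ x ∷ w ∷ k ∷ l ∷ m ∷ i ∷ j ∷ v₁ ∷ v₂ ∷ v₃ ∷ [])) ≡ + 0))
theorem7 = binomial-poly , λ y n s 0<s s≤n → mk⇔
  (λ y≡ → evaluate s≤n (binomial-complete 0<s s≤n y≡))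
  (λ (x , w , k , l , m , i , j , v₁ , v₂ , v₃ , eq) →
    binomial-sound {y} {n} {s} {x} {w} {k} {l} {m} {i} {j} {v₁} {v₂} {v₃} 0<s s≤n
      (trans (sym (evalℕ-binomial-poly y n s x w k l m i j v₁ v₂ v₃ s≤n)) eq))
  where
  evaluate : ∀ {y n s} → s ≤ n →
    ∃[ x ] ∃[ w ] ∃[ k ] ∃[ l ] ∃[ m ] ∃[ i ] ∃[ j ] ∃[ v₁ ] ∃[ v₂ ] ∃[ v₃ ] binomial-form y n s x w k l m i j v₁ v₂ v₃ ≡ + 0 →
    ∃[ x ] ∃[ w ] ∃[ k ] ∃[ l ] ∃[ m ] ∃[ i ] ∃[ j ] ∃[ v₁ ] ∃[ v₂ ] ∃[ v₃ ]
    (evalℕ binomial-poly (lookup (y ∷ n ∷ s ∷ x ∷ w ∷ k ∷ l ∷ m ∷ i ∷ j ∷ v₁ ∷ v₂ ∷ v₃ ∷ [])) ≡ + 0)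
  evaluate {y} {n} {s} s≤n (x , w , k , l , m , i , j , v₁ , v₂ , v₃ , eq) =
    x , w , k , l , m , i , j , v₁ , v₂ , v₃ , trans (evalℕ-binomial-poly y n s x w k l m i j v₁ v₂ v₃ s≤n) eq
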